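{- Let $q=p^r>3$ with $p\ne 2$ prime. Define $f_1,f_2,f_3$ by $$f_1=x_1,\qquad f_i(x_1,\dots,x_i)=t\bigl(f_{i-1}(x_1,\dots,x_{i-1})^{q-2}+x_i^{q-2}\bigr)\quad (i=2,3),$$ reduced modulo $x_j^q-x_j$ for all $j$. Then $f_3(x_1,x_2,x_3)$, which is a local permutation polynomial with coefficients in $\mathbb{F}_p$, has degree $3(q-2)$.
   Context: $\mathbb{F}_q$ is the finite field with $q=p^r$ elements, and $$t(x)=x+\sum_{k=0}^{q-2}x^k\in\mathbb{F}_q[x];$$ this polynomial swaps $0$ and $1$ and fixes every other element of $\mathbb{F}_q$. A polynomial $f\in\mathbb{F}_q[x_1,\dots,x_n]$ is a local permutation polynomial (LPP) if, for each $i$ and each fixing of the other variables to values in $\mathbb{F}_q$, the resulting univariate polynomial in $x_i$ induces a bijection of $\mathbb{F}_q$. Degree means total degree of the reduced representative (degree $<q$ in each variable). -}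

module Defs where

open import Algebra.Bundles using (CommutativeRing)
open import Data.Bool.Base using (if_then_else_)
open import Data.Fin.Base using (Fin; toℕ)
open import Data.Fin.Patterns using (0F; 1F; 2F)
open import Data.List.Base using (List; []; _∷_; _++_; map; foldr; concatMap; cartesianProductWith; upTo)
open import Data.Nat.Base as ℕ using (ℕ; zero; suc; _∸_; _≤_)
open import Data.Nat.Properties using (_≟_)
open import Data.Product.Base using (_×_; _,_; ∃; map₂)
open import Data.Vec.Base as Vec using (Vec; _[_]≔_)
open import Data.Vec.Properties using (≡-dec)
open import Function.Bundles using (Bijection)
open import Function.Definitions using (Bijective)
open import Level using (_⊔_)
open import Relation.Binary.PropositionalEquality.Core using (_≡_)
open import Relation.Binary.PropositionalEquality.Properties using () renaming (setoid to ≡-setoid)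
open import Relation.Nullary.Decidable.Core using (does)

Exponent : ℕ → Set
Exponent n = Vec ℕ n

-- The exponent of x ^ e modulo x ^ q - x: multiply by x one factor at a time,
-- rewriting x ^ q to x whenever it appears.
reduceExp : ℕ → ℕ → ℕ
reduceExp q zero    = 0
reduceExp q (suc e) = if does (suc (reduceExp q e) ≟ q) then 1 else suc (reduceExp q e)

module _ {c ℓ} (K : CommutativeRing c ℓ) where

  open CommutativeRing K
  open import Algebra.Properties.Semiring.Exp semiring using (_^_)
  open import Algebra.Properties.Semiring.Mult semiring using () renaming (_×_ to _·_)

  record IsFiniteField (q : ℕ) : Set (c ⊔ ℓ) where
    field
      1≉0         : 1# ≉ 0#
      inverse     : ∀ x → x ≉ 0# → ∃ λ y → x * y ≈ 1#
      enumeration : Bijection (≡-setoid (Fin q)) setoid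

  -- The prime field, as the image of {0, …, p - 1} under ℤ → K.
  InPrimeField : ℕ → Carrier → Set ℓ
  InPrimeField p a = ∃ λ (k : Fin p) → a ≈ toℕ k · 1#

  -- A polynomial is a formal sum of terms a x₁^e₁ ⋯ xₙ^eₙ, in which an exponent
  -- may occur several times; its actual coefficients are given by `coeff`.
  Poly : ℕ → Set c
  Poly n = List (Carrier × Exponent n)

  sum : List Carrier → Carrier
  sum = foldr _+_ 0#

  module _ {n : ℕ} where

    coeff : Poly n → Exponent n → Carrier
    coeff f e = sum (map (λ (a , e′) → if does (≡-dec _≟_ e′ e) then a else 0#) f)

    eval : Poly n → Vec Carrier n → Carrier
    eval f v = sum (map (λ (a , e) → a * Vec.foldr′ _*_ 1# (Vec.zipWith _^_ v e)) f)

    const : Carrier → Poly n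
    const a = (a , Vec.replicate n 0) ∷ []

    X : Fin n → Poly n
    X i = (1# , Vec.replicate n 0 [ i ]≔ 1) ∷ []

    infixl 6 _⊕_
    infixl 7 _⊗_
    infixr 8 _↑_

    _⊕_ : Poly n → Poly n → Poly n
    _⊕_ = _++_

    _⊗_ : Poly n → Poly n → Poly n
    _⊗_ = cartesianProductWith λ (a , d) (b , e) → (a * b , Vec.zipWith ℕ._+_ d e)

    _↑_ : Poly n → ℕ → Poly n
    f ↑ zero  = const 1#
    f ↑ suc k = f ⊗ f ↑ k

    _⟦_⟧ : Poly 1 → Poly n → Poly n
    h ⟦ g ⟧ = concatMap (λ (a , e) → const a ⊗ g ↑ Vec.head e) h

    -- The representative of degree < q in each variable, modulo all xⱼ^q - xⱼ.
    reduce : ℕ → Poly n → Poly n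
    reduce q = map (map₂ (Vec.map (reduceExp q)))

    HasDegree : Poly n → ℕ → Set ℓ
    HasDegree f d =
      (∃ λ e → coeff f e ≉ 0# × Vec.sum e ≡ d) ×
      (∀ e → coeff f e ≉ 0# → Vec.sum e ≤ d)

    HasCoefficientsInPrimeField : ℕ → Poly n → Set ℓ
    HasCoefficientsInPrimeField p f = ∀ e → InPrimeField p (coeff f e)

    -- The i-th entry of v is overwritten, so v only fixes the other variables.
    IsLocalPermutationPolynomial : Poly n → Set (c ⊔ ℓ)
    IsLocalPermutationPolynomial f =
      ∀ (i : Fin n) (v : Vec Carrier n) → Bijective _≈_ _≈_ (λ x → eval f (v [ i ]≔ x))

  -- upTo (q ∸ 1) lists k = 0, …, q - 2.
  t : ℕ → Poly 1
  t q = X 0F ⊕ concatMap (λ k → X 0F ↑ k) (upTo (q ∸ 1))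

  f₁ : Poly 3
  f₁ = X 0F

  f₂ : ℕ → Poly 3
  f₂ q = reduce q (t q ⟦ f₁ ↑ (q ∸ 2) ⊕ X 1F ↑ (q ∸ 2) ⟧)

  f₃ : ℕ → Poly 3
  f₃ q = reduce q (t q ⟦ f₂ q ↑ (q ∸ 2) ⊕ X 2F ↑ (q ∸ 2) ⟧)

{-# OPTIONS --safe #-}
module Submission where

-- On 𝔽_q the map inv x = x ^ (q - 2) inverts the nonzero elements and fixes 0, and t
-- swaps 0 and 1. Hence f₃(a, b, c) = t(inv(t(inv a + inv b)) + inv c) is, in each variable,
-- a composition of permutations. The coefficients of a reduced polynomial f are
-- recovered from its values as sums of f against a basis dual to the monomials, which
-- exists because ∑ x ^ k vanishes for 0 ≤ k < q - 1 and equals -1 for k = q - 1. For an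
-- exponent with an entry q - 1 the dual function does not depend on that variable, and
-- the sum vanishes since f₃ permutes 𝔽_q in it; so the degree is at most 3(q - 2).
-- The coefficient at (q - 2, q - 2, q - 2) is -∑ a b c f₃(a, b, c). Writing t(x) as
-- x + δ(x) - δ(x - 1), with δ the indicator function of 0, and summing over c, over a
-- with inv a + inv b = s fixed, and over s in turn, one finds that this sum is 4, which
-- is nonzero in odd characteristic.

open import Defs
open import Algebra.Bundles using (CommutativeRing; CommutativeMonoid)
import Algebra.Properties.CommutativeMonoid.Sum as MonoidSum
import Algebra.Properties.CommutativeSemiring.Exp as Exp
import Algebra.Properties.Group as GroupProperties
import Algebra.Properties.Monoid.Mult as MonoidMult
import Algebra.Properties.Ring as RingProperties
import Algebra.Properties.Semiring.Mult as Mult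
import Algebra.Properties.Semiring.Mult.TCOptimised as MultTC
import Algebra.Solver.Ring as RingSolver
open import Algebra.Solver.Ring.AlmostCommutativeRing using (fromCommutativeRing; _-Raw-AlmostCommutative⟶_)
open import Data.Bool.Base using (if_then_else_)
open import Data.Fin.Base as Fin using (Fin; zero; suc; punchIn)
import Data.Fin.Permutation as Perm
import Data.Fin.Properties as Fin
open import Data.Integer.Base as ℤ using (ℤ)
import Data.Integer.Properties as ℤ
open import Data.List.Base using (List; []; _∷_; _++_; map; concatMap; upTo)
import Data.List.Properties as List
open import Data.List.Relation.Unary.All as All using (All; []; _∷_)
import Data.List.Relation.Unary.All.Properties as All
open import Data.Maybe.Base using (Maybe; just; nothing)
open import Data.Nat.Base as ℕ using (ℕ; zero; suc; _<_; _≤_; z≤n; s≤s)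
open import Data.Nat.DivMod using (_%_; _/_; m≡m%n+[m/n]*n; m%n<n)
open import Data.Nat.Divisibility using (m%n≡0⇒n∣m)
open import Data.Nat.Primality using (Prime; prime⇒nonZero; prime⇒irreducible)
import Data.Nat.Properties as ℕ
open import Data.Product.Base using (_×_; _,_; ∃; proj₁; proj₂)
open import Data.Sum.Base using (inj₂)
open import Data.Vec.Base as Vec using (Vec; []; _∷_; _[_]≔_)
open import Data.Vec.Properties using (≡-dec)
open import Data.Vec.Relation.Unary.All as VecAll using ([]; _∷_)
import Data.Vec.Relation.Unary.All.Properties as VecAll
open import Function.Base using (_∘_)
open import Function.Bundles using (Bijection; Inverse)
open import Function.Construct.Composition using () renaming (inverse to infixr 5 _⨾_)
open import Function.Definitions using (Injective)
open import Relation.Binary.Definitions using (Tri; tri<; tri≈; tri>)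
open import Relation.Binary.PropositionalEquality.Core as ≡ using (_≡_; _≢_)
import Relation.Binary.Reasoning.Setoid as SetoidReasoning
open import Relation.Nullary using (¬_; Dec; does; yes; no; contradiction)
open import Relation.Nullary.Decidable using (map′; decidable-stable)

-- Ring identities with integer coefficients

module IntegerCoefficientSolver {c ℓ} (R : CommutativeRing c ℓ) where

  private
    open import Data.Integer.Base using (+_; -[1+_]; _⊖_)
    module R = CommutativeRing R
    open R using (_≈_; 1#; 0#; refl; sym; trans; +-cong; +-congˡ)
    open RingProperties R.ring
    open MultTC R.semiring using (×-homo-+; 1+×; ×1-homo-*) renaming (_×_ to _·_)
    open SetoidReasoning R.setoid

    -- Integers serve as the coefficients of normal forms: their equality is decidable, so that
    -- terms of opposite sign cancel, and the resulting identities hold in every commutative ring.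
    ⟦_⟧ : ℤ → R.Carrier
    ⟦ + n ⟧      = n · 1#
    ⟦ -[1+ n ] ⟧ = R.- (suc n · 1#)

    cancel-1 : ∀ x y → (1# R.+ x) R.- (1# R.+ y) ≈ x R.- y
    cancel-1 x y = begin
      (1# R.+ x) R.- (1# R.+ y)          ≈⟨ +-cong (R.+-comm 1# x) (sym (-‿+-comm 1# y)) ⟩
      (x R.+ 1#) R.+ (R.- 1# R.- y)      ≈⟨ R.+-assoc x 1# _ ⟩
      x R.+ (1# R.+ (R.- 1# R.- y))      ≈⟨ +-congˡ (sym (R.+-assoc 1# (R.- 1#) (R.- y))) ⟩
      x R.+ ((1# R.- 1#) R.- y)          ≈⟨ +-congˡ (R.+-congʳ (R.-‿inverseʳ 1#)) ⟩
      x R.+ (0# R.- y)                   ≈⟨ +-congˡ (R.+-identityˡ _) ⟩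
      x R.- y                            ∎

    ⊖-homo : ∀ m n → ⟦ m ⊖ n ⟧ ≈ (m · 1#) R.- (n · 1#)
    ⊖-homo m       zero    = sym (trans (+-congˡ -0#≈0#) (R.+-identityʳ _))
    ⊖-homo zero    (suc n) = sym (R.+-identityˡ _)
    ⊖-homo (suc m) (suc n) = begin
      ⟦ suc m ⊖ suc n ⟧                            ≡⟨ ≡.cong ⟦_⟧ (ℤ.[1+m]⊖[1+n]≡m⊖n m n) ⟩
      ⟦ m ⊖ n ⟧                                    ≈⟨ ⊖-homo m n ⟩
      (m · 1#) R.- (n · 1#)                        ≈⟨ cancel-1 _ _ ⟨
      (1# R.+ m · 1#) R.- (1# R.+ n · 1#)          ≈⟨ +-cong (1+× m 1#) (R.-‿cong (1+× n 1#)) ⟨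
      (suc m · 1#) R.- (suc n · 1#)                ∎

    +-homo : ∀ i j → ⟦ i ℤ.+ j ⟧ ≈ ⟦ i ⟧ R.+ ⟦ j ⟧
    +-homo (+ m)    (+ n)    = ×-homo-+ 1# m n
    +-homo (+ m)    -[1+ n ] = ⊖-homo m (suc n)
    +-homo -[1+ m ] (+ n)    = trans (⊖-homo n (suc m)) (R.+-comm _ _)
    +-homo -[1+ m ] -[1+ n ] = begin
      R.- (suc (suc (m ℕ.+ n)) · 1#)       ≡⟨ ≡.cong (λ k → R.- (suc k · 1#)) (ℕ.+-suc m n) ⟨
      R.- ((suc m ℕ.+ suc n) · 1#)         ≈⟨ R.-‿cong (×-homo-+ 1# (suc m) (suc n)) ⟩
      R.- (suc m · 1# R.+ suc n · 1#)      ≈⟨ -‿+-comm _ _ ⟨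
      R.- (suc m · 1#) R.- (suc n · 1#)    ∎

    -‿homo : ∀ i → ⟦ ℤ.- i ⟧ ≈ R.- ⟦ i ⟧
    -‿homo (+ zero)  = sym -0#≈0#
    -‿homo (+ suc n) = refl
    -‿homo -[1+ n ]  = sym (-‿involutive _)

    *-homo-+ : ∀ m j → ⟦ + m ℤ.* j ⟧ ≈ ⟦ + m ⟧ R.* ⟦ j ⟧
    *-homo-+ m (+ n)    = trans (R.reflexive (≡.cong ⟦_⟧ (≡.sym (ℤ.pos-* m n)))) (×1-homo-* m n)
    *-homo-+ m -[1+ n ] = begin
      ⟦ + m ℤ.* -[1+ n ] ⟧             ≡⟨ ≡.cong ⟦_⟧ (ℤ.neg-distribʳ-* (+ m) (+ suc n)) ⟨
      ⟦ ℤ.- (+ m ℤ.* + suc n) ⟧        ≈⟨ -‿homo (+ m ℤ.* + suc n) ⟩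
      R.- ⟦ + m ℤ.* + suc n ⟧          ≈⟨ R.-‿cong (*-homo-+ m (+ suc n)) ⟩
      R.- (⟦ + m ⟧ R.* ⟦ + suc n ⟧)    ≈⟨ -‿distribʳ-* _ _ ⟩
      ⟦ + m ⟧ R.* ⟦ -[1+ n ] ⟧         ∎

    *-homo : ∀ i j → ⟦ i ℤ.* j ⟧ ≈ ⟦ i ⟧ R.* ⟦ j ⟧
    *-homo (+ m)    j = *-homo-+ m j
    *-homo -[1+ m ] j = begin
      ⟦ -[1+ m ] ℤ.* j ⟧          ≡⟨ ≡.cong ⟦_⟧ (ℤ.neg-distribˡ-* (+ suc m) j) ⟨
      ⟦ ℤ.- (+ suc m ℤ.* j) ⟧     ≈⟨ -‿homo (+ suc m ℤ.* j) ⟩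
      R.- ⟦ + suc m ℤ.* j ⟧       ≈⟨ R.-‿cong (*-homo-+ (suc m) j) ⟩
      R.- (⟦ + suc m ⟧ R.* ⟦ j ⟧) ≈⟨ -‿distribˡ-* _ _ ⟩
      ⟦ -[1+ m ] ⟧ R.* ⟦ j ⟧      ∎

    morphism : ℤ.+-*-rawRing -Raw-AlmostCommutative⟶ fromCommutativeRing R
    morphism = record
      { ⟦_⟧ = ⟦_⟧ ; +-homo = +-homo ; *-homo = *-homo ; -‿homo = -‿homo ; 0-homo = refl ; 1-homo = refl }

    _≟_ : ∀ i j → Maybe (⟦ i ⟧ ≈ ⟦ j ⟧)
    i ≟ j with i ℤ.≟ j
    ... | yes i≡j = just (R.reflexive (≡.cong ⟦_⟧ i≡j))
    ... | no  _   = nothing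

  open RingSolver _ (fromCommutativeRing R) morphism _≟_ public
    using (Polynomial; solve; _:=_; _:+_; _:*_; _:-_; :-_; con)

  :0 :1 : ∀ {k} → Polynomial k
  :0 = con (ℤ.+ 0)
  :1 = con (ℤ.+ 1)

-- For the conditionals in `reduceExp` and `coeff`, which branch on a Boolean: each branch regains
-- the proof or refutation behind that Boolean.
if-dec : ∀ {a p r} {A : Set a} {P : Set p} (Q : A → Set r) {x y : A} (d : Dec P) →
         (P → Q x) → (¬ P → Q y) → Q (if does d then x else y)
if-dec Q (yes p) Qx Qy = Qx p
if-dec Q (no ¬p) Qx Qy = Qy ¬p

reduceExp<q : ∀ {q} → 1 < q → ∀ e → reduceExp q e < q
reduceExp<q 1<q zero    = ℕ.<-trans (s≤s z≤n) 1<q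
reduceExp<q {q} 1<q (suc e) = if-dec (_< q) (suc (reduceExp q e) ℕ.≟ q)
  (λ _ → 1<q) (λ ≢q → ℕ.≤∧≢⇒< (reduceExp<q 1<q e) ≢q)

-- Formal polynomials and their values

module Polynomials {c ℓ} (K : CommutativeRing c ℓ) where

  open CommutativeRing K renaming (zero to *-zero)
  open Exp commutativeSemiring using (_^_; ^-congˡ; ^-homo-*)
  open Mult semiring using (×-homo-+; ×1-homo-*) renaming (_×_ to _·_)
  open IntegerCoefficientSolver K
  open SetoidReasoning setoid

  monomial : ∀ {m} → Vec Carrier m → Exponent m → Carrier
  monomial v d = Vec.foldr′ _*_ 1# (Vec.zipWith _^_ v d)

  monomial-+ : ∀ {m} (v : Vec Carrier m) d e →
               monomial v (Vec.zipWith ℕ._+_ d e) ≈ monomial v d * monomial v e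
  monomial-+ []      []      []      = sym (*-identityˡ 1#)
  monomial-+ (x ∷ v) (i ∷ d) (j ∷ e) = trans (*-cong (^-homo-* x i j) (monomial-+ v d e))
    (solve 4 (λ a b c d → a :* b :* (c :* d) := a :* c :* (b :* d)) refl _ _ _ _)

  monomial-0 : ∀ {m} (v : Vec Carrier m) → monomial v (Vec.replicate m 0) ≈ 1#
  monomial-0 []      = refl
  monomial-0 (x ∷ v) = trans (*-identityˡ _) (monomial-0 v)

  monomial-X : ∀ {m} (v : Vec Carrier m) i → monomial v (Vec.replicate m 0 [ i ]≔ 1) ≈ Vec.lookup v i
  monomial-X (x ∷ v) zero    = trans (*-cong (*-identityʳ x) (monomial-0 v)) (*-identityʳ x)
  monomial-X (x ∷ v) (suc i) = trans (*-identityˡ _) (monomial-X v i)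

  module _ {m : ℕ} (v : Vec Carrier m) where

    eval-⊕ : ∀ f g → eval K (f ++ g) v ≈ eval K f v + eval K g v
    eval-⊕ []      g = sym (+-identityˡ _)
    eval-⊕ (_ ∷ f) g = trans (+-congˡ (eval-⊕ f g)) (sym (+-assoc _ _ _))

    eval-⊗ : ∀ f g → eval K (_⊗_ K f g) v ≈ eval K f v * eval K g v
    eval-⊗ []            g = sym (zeroˡ _)
    eval-⊗ ((a , d) ∷ f) g = begin
      eval K (map term g ++ _⊗_ K f g) v                        ≈⟨ eval-⊕ (map term g) (_⊗_ K f g) ⟩
      eval K (map term g) v + eval K (_⊗_ K f g) v              ≈⟨ +-cong (eval-term g) (eval-⊗ f g) ⟩
      a * monomial v d * eval K g v + eval K f v * eval K g v   ≈⟨ distribʳ _ _ _ ⟨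
      (a * monomial v d + eval K f v) * eval K g v              ∎
      where
      term : Carrier × Exponent m → Carrier × Exponent m
      term (b , e) = a * b , Vec.zipWith ℕ._+_ d e
      eval-term : ∀ g → eval K (map term g) v ≈ a * monomial v d * eval K g v
      eval-term []            = sym (zeroʳ _)
      eval-term ((b , e) ∷ g) = trans (+-cong (*-congˡ (monomial-+ v d e)) (eval-term g))
        (solve 5 (λ a b x y z → a :* b :* (x :* y) :+ a :* x :* z := a :* x :* (b :* y :+ z)) refl a b _ _ _)

    eval-const : ∀ a → eval K (const K a) v ≈ a
    eval-const a = trans (+-identityʳ _) (trans (*-congˡ (monomial-0 v)) (*-identityʳ a))

    eval-X : ∀ i → eval K (X K i) v ≈ Vec.lookup v i
    eval-X i = trans (+-identityʳ _) (trans (*-identityˡ _) (monomial-X v i))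

    eval-↑ : ∀ f k → eval K (_↑_ K f k) v ≈ eval K f v ^ k
    eval-↑ f zero    = eval-const 1#
    eval-↑ f (suc k) = trans (eval-⊗ f (_↑_ K f k)) (*-congˡ (eval-↑ f k))

    eval-⟦⟧ : ∀ h g → eval K (_⟦_⟧ K h g) v ≈ eval K h (eval K g v ∷ [])
    eval-⟦⟧ []                  g = refl
    eval-⟦⟧ ((a , k ∷ []) ∷ h) g = begin
      eval K (_⊗_ K (const K a) (_↑_ K g k) ++ _⟦_⟧ K h g) v
        ≈⟨ eval-⊕ (_⊗_ K (const K a) (_↑_ K g k)) (_⟦_⟧ K h g) ⟩
      eval K (_⊗_ K (const K a) (_↑_ K g k)) v + eval K (_⟦_⟧ K h g) v
        -- The factor `1#` is the empty product that ends a monomial in one variable.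
        ≈⟨ +-cong (trans (eval-⊗ (const K a) (_↑_ K g k)) (*-cong (eval-const a) (trans (eval-↑ g k) (sym (*-identityʳ _))))) (eval-⟦⟧ h g) ⟩
      a * (eval K g v ^ k * 1#) + eval K h (eval K g v ∷ []) ∎

  module _ {q : ℕ} (x^q≈x : ∀ x → x ^ q ≈ x) where

    -- An exponent changes only where x ^ q is rewritten to x, and there the values agree because x
    -- ^ q = x on the whole field.
    ^-reduceExp : ∀ x e → x ^ reduceExp q e ≈ x ^ e
    ^-reduceExp x zero    = refl
    ^-reduceExp x (suc e) = if-dec (λ k → x ^ k ≈ x ^ suc e) (suc (reduceExp q e) ℕ.≟ q)
      (λ eq → begin
        x ^ 1                      ≈⟨ *-identityʳ x ⟩
        x                          ≈⟨ x^q≈x x ⟨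
        x ^ q                      ≡⟨ ≡.cong (x ^_) eq ⟨
        x * x ^ reduceExp q e      ≈⟨ *-congˡ (^-reduceExp x e) ⟩
        x * x ^ e                  ∎)
      (λ _ → *-congˡ (^-reduceExp x e))

    eval-reduce : ∀ {m} (f : Poly K m) v → eval K (reduce K q f) v ≈ eval K f v
    eval-reduce []            v = refl
    eval-reduce ((a , d) ∷ f) v = +-cong (*-congˡ (monomial-reduce v d)) (eval-reduce f v)
      where
      monomial-reduce : ∀ {m} (v : Vec Carrier m) d → monomial v (Vec.map (reduceExp q) d) ≈ monomial v d
      monomial-reduce []      []      = refl
      monomial-reduce (x ∷ v) (k ∷ d) = *-cong (^-reduceExp x k) (monomial-reduce v d)

  -- The values of t

  geometric : Carrier → ℕ → Carrier
  geometric x zero    = 0#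
  geometric x (suc k) = geometric x k + x ^ k

  eval-t : ∀ q x → eval K (t K q) (x ∷ []) ≈ x + geometric x (q ℕ.∸ 1)
  eval-t q x = trans (eval-⊕ (x ∷ []) (X K zero) (Xs (upTo (q ℕ.∸ 1)))) (+-cong (eval-X (x ∷ []) zero) (powers (q ℕ.∸ 1)))
    where
    Xs : List ℕ → Poly K 1
    Xs = concatMap (λ k → _↑_ K (X K zero) k)
    powers : ∀ k → eval K (Xs (upTo k)) (x ∷ []) ≈ geometric x k
    powers zero    = refl
    powers (suc k) = begin
      eval K (Xs (upTo (suc k))) (x ∷ [])
        -- The list `upTo` unfolds from the front, whereas the induction splits off the last power.
        ≡⟨ ≡.cong (λ p → eval K p (x ∷ [])) (≡.trans (≡.cong Xs (≡.sym (List.upTo-∷ʳ k))) (List.concatMap-++ _ (upTo k) (k ∷ []))) ⟩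
      eval K (Xs (upTo k) ++ Xs (k ∷ [])) (x ∷ [])
        ≈⟨ eval-⊕ (x ∷ []) (Xs (upTo k)) (Xs (k ∷ [])) ⟩
      eval K (Xs (upTo k)) (x ∷ []) + eval K (Xs (k ∷ [])) (x ∷ [])
        ≈⟨ +-cong (powers k) (trans (eval-⊕ (x ∷ []) (_↑_ K (X K zero) k) []) (trans (+-identityʳ _)
             (trans (eval-↑ (x ∷ []) (X K zero) k) (^-congˡ k (eval-X (x ∷ []) zero))))) ⟩
      geometric x k + x ^ k ∎

  -- Determines the power sum in `t` away from x = 1; at x = 1 the factor x - 1 vanishes, and
  -- `geometric-1` counts the terms instead.
  geometric-telescopes : ∀ x k → (x - 1#) * geometric x k + 1# ≈ x ^ k
  geometric-telescopes x zero    = solve 1 (λ x → (x :- :1) :* :0 :+ :1 := :1) refl x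
  geometric-telescopes x (suc k) = begin
    (x - 1#) * (geometric x k + x ^ k) + 1#
      ≈⟨ solve 3 (λ x g y → (x :- :1) :* (g :+ y) :+ :1 := ((x :- :1) :* g :+ :1) :+ (x :- :1) :* y)
           refl x (geometric x k) (x ^ k) ⟩
    (x - 1#) * geometric x k + 1# + (x - 1#) * x ^ k
      ≈⟨ +-congʳ (geometric-telescopes x k) ⟩
    x ^ k + (x - 1#) * x ^ k
      ≈⟨ solve 2 (λ x y → y :+ (x :- :1) :* y := x :* y) refl x (x ^ k) ⟩
    x * x ^ k ∎

  geometric-1 : ∀ {x} → x ≈ 1# → ∀ k → geometric x k ≈ k · 1#
  geometric-1 x≈1 zero    = refl
  geometric-1 {x} x≈1 (suc k) = trans (+-cong (geometric-1 x≈1 k) (x^k≈1 k)) (+-comm _ 1#)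
    where
    x^k≈1 : ∀ k → x ^ k ≈ 1#
    x^k≈1 zero    = refl
    x^k≈1 (suc k) = trans (*-cong x≈1 (x^k≈1 k)) (*-identityˡ 1#)

  -- Coefficients that are natural multiples of 1

  Natural : Carrier → Set ℓ
  Natural a = ∃ λ k → a ≈ k · 1#

  natural-1 : Natural 1#
  natural-1 = 1 , sym (+-identityʳ 1#)

  natural-+ : ∀ {a b} → Natural a → Natural b → Natural (a + b)
  natural-+ (j , a≈j) (k , b≈k) = j ℕ.+ k , trans (+-cong a≈j b≈k) (sym (×-homo-+ 1# j k))

  natural-* : ∀ {a b} → Natural a → Natural b → Natural (a * b)
  natural-* (j , a≈j) (k , b≈k) = j ℕ.* k , trans (*-cong a≈j b≈k) (sym (×1-homo-* j k))

  -- Every term of f₃ arises from coefficients 1 by sums and products, and unbounded multiples of 1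
  -- are closed under both. Bringing the multiple below p is left to `natural⇒inPrimeField`.
  NaturalPoly : ∀ {m} → Poly K m → Set _
  NaturalPoly = All (Natural ∘ proj₁)

  natural-⊗ : ∀ {m} {f g : Poly K m} → NaturalPoly f → NaturalPoly g → NaturalPoly (_⊗_ K f g)
  natural-⊗ []       gs = []
  natural-⊗ (a ∷ fs) gs = All.++⁺ (All.map⁺ (All.map (natural-* a) gs)) (natural-⊗ fs gs)

  natural-↑ : ∀ {m} {f : Poly K m} → NaturalPoly f → ∀ k → NaturalPoly (_↑_ K f k)
  natural-↑ fs zero    = natural-1 ∷ []
  natural-↑ fs (suc k) = natural-⊗ fs (natural-↑ fs k)

  natural-⟦⟧ : ∀ {m h} {g : Poly K m} → NaturalPoly h → NaturalPoly g → NaturalPoly (_⟦_⟧ K h g)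
  natural-⟦⟧ {h = []}              []       gs = []
  natural-⟦⟧ {h = (_ , e) ∷ _} (a ∷ hs) gs =
    All.++⁺ (natural-⊗ (a ∷ []) (natural-↑ gs (Vec.head e))) (natural-⟦⟧ hs gs)

  natural-reduce : ∀ {m q} {f : Poly K m} → NaturalPoly f → NaturalPoly (reduce K q f)
  natural-reduce = All.map⁺

  natural-t : ∀ q → NaturalPoly (t K q)
  natural-t q = natural-1 ∷ All.concat⁺ (All.map⁺ (All.universal (natural-↑ (natural-1 ∷ [])) (upTo (q ℕ.∸ 1))))

  natural-f₃ : ∀ q → NaturalPoly (f₃ K q)
  natural-f₃ q = step (step (natural-1 ∷ []) (natural-1 ∷ [])) (natural-1 ∷ [])
    where
    step : ∀ {f g : Poly K 3} → NaturalPoly f → NaturalPoly g →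
           NaturalPoly (reduce K q (_⟦_⟧ K (t K q) (_↑_ K f (q ℕ.∸ 2) ++ _↑_ K g (q ℕ.∸ 2))))
    step fs gs = natural-reduce (natural-⟦⟧ (natural-t q) (All.++⁺ (natural-↑ fs (q ℕ.∸ 2)) (natural-↑ gs (q ℕ.∸ 2))))

  natural-coeff : ∀ {m} {f : Poly K m} → NaturalPoly f → ∀ e → Natural (coeff K f e)
  natural-coeff                    []       e = 0 , refl
  natural-coeff {f = (_ , d) ∷ _} (a ∷ fs) e =
    natural-+ (if-dec Natural (≡-dec ℕ._≟_ d e) (λ _ → a) (λ _ → 0 , refl)) (natural-coeff fs e)

  -- Exponents of reduced polynomials

  ReducedPoly : ∀ {m} → ℕ → Poly K m → Set _
  ReducedPoly q = All (VecAll.All (_< q) ∘ proj₂)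

  reduce-reduced : ∀ {m q} → 1 < q → (f : Poly K m) → ReducedPoly q (reduce K q f)
  reduce-reduced {q = q} 1<q f = All.map⁺ (All.universal (λ (_ , d) → VecAll.map⁺ (VecAll.universal (reduceExp<q 1<q) d)) f)

  coeff≈0 : ∀ {m} {f : Poly K m} {e} → All (λ (_ , d) → d ≢ e) f → coeff K f e ≈ 0#
  coeff≈0                          []       = refl
  coeff≈0 {f = (_ , d) ∷ _} {e} (d≢e ∷ fs) = trans (+-cong
    (if-dec (_≈ 0#) (≡-dec ℕ._≟_ d e) (λ d≡e → contradiction d≡e d≢e) (λ _ → refl)) (coeff≈0 fs)) (+-identityˡ 0#)

  coeff-reduced≈0 : ∀ {m q} {f : Poly K m} → ReducedPoly q f → ∀ {e} → ¬ VecAll.All (_< q) e → coeff K f e ≈ 0#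
  coeff-reduced≈0 fs {e} e≮q = coeff≈0 (All.map (λ d<q d≡e → e≮q (≡.subst (VecAll.All _) d≡e d<q)) fs)

-- The field with q elements

module FiniteField {c ℓ} (K : CommutativeRing c ℓ) (n : ℕ) (isFiniteField : IsFiniteField K (4 ℕ.+ n)) where

  -- In the form 4 + n, the truncated differences q - 1 and q - 2 compute to 3 + n and 2 + n.
  q : ℕ
  q = 4 ℕ.+ n

  open CommutativeRing K renaming (zero to *-zero)
  open IsFiniteField isFiniteField
  open Exp commutativeSemiring using (_^_; ^-congˡ; ^-homo-*; ^-distrib-*)
  open Mult semiring using (×-homo-+; ×1-homo-*) renaming (_×_ to _·_)
  open RingProperties ring using (+-identityʳ-unique; -0#≈0#; -‿+-comm; -‿distribʳ-*; -‿involutive; -1*x≈-x)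
  open GroupProperties +-group using (x∙y⁻¹≈ε⇒x≈y; x≈y⇒x∙y⁻¹≈ε)
  open IntegerCoefficientSolver K
  open SetoidReasoning setoid

  open Bijection enumeration using (surjective) renaming (to to enum; injective to enum-injective)

  index : Carrier → Fin q
  index x = proj₁ (surjective x)

  enum-index : ∀ x → enum (index x) ≈ x
  enum-index x = proj₂ (surjective x) ≡.refl

  index-enum : ∀ i → index (enum i) ≡ i
  index-enum i = enum-injective (enum-index (enum i))

  index-cong : ∀ {x y} → x ≈ y → index x ≡ index y
  index-cong {x} {y} x≈y = enum-injective (trans (enum-index x) (trans x≈y (sym (enum-index y))))

  index-injective : ∀ {x y} → index x ≡ index y → x ≈ y
  index-injective {x} {y} eq = trans (sym (enum-index x)) (trans (reflexive (≡.cong enum eq)) (enum-index y))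

  -- Decidability is inherited from `Fin q` through the enumeration, and makes the case distinctions
  -- at 0 and 1 below possible.
  _≈?_ : ∀ x y → Dec (x ≈ y)
  x ≈? y = map′ index-injective index-cong (index x Fin.≟ index y)

  -- Permutations of the field

  Congruent : (Carrier → Carrier) → Set _
  Congruent f = ∀ {x y} → x ≈ y → f x ≈ f y

  Perm : Set _
  Perm = Inverse setoid setoid

  mkPerm : (f g : Carrier → Carrier) → Congruent f → Congruent g →
           (∀ x → f (g x) ≈ x) → (∀ x → g (f x) ≈ x) → Perm
  mkPerm f g f-cong g-cong fg gf = record
    { to        = f
    ; from      = g
    ; to-cong   = f-cong
    ; from-cong = g-cong
    ; inverse   = (λ y≈gx → trans (f-cong y≈gx) (fg _)) , (λ y≈fx → trans (g-cong y≈fx) (gf _))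
    }

  translation : Carrier → Perm
  translation a = mkPerm (a +_) (- a +_) +-congˡ +-congˡ
    (λ x → solve 2 (λ a x → a :+ (:- a :+ x) := x) refl a x)
    (λ x → solve 2 (λ a x → :- a :+ (a :+ x) := x) refl a x)

  reflection : Carrier → Perm
  reflection a = mkPerm (λ x → a - x) (λ x → a - x) (+-congˡ ∘ -‿cong) (+-congˡ ∘ -‿cong) inv inv
    where
    inv : ∀ x → a - (a - x) ≈ x
    inv = solve 2 (λ a x → a :- (a :- x) := x) refl a

  dilation : ∀ {a} → a ≉ 0# → Perm
  dilation {a} a≉0 with inverse a a≉0
  ... | b , ab≈1 = mkPerm (a *_) (b *_) *-congˡ *-congˡ
    (λ x → trans (sym (*-assoc a b x)) (trans (*-congʳ ab≈1) (*-identityˡ x)))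
    (λ x → trans (sym (*-assoc b a x)) (trans (*-congʳ (trans (*-comm b a) ab≈1)) (*-identityˡ x)))

  -- Sums and products over the field

  module OverField {a b} (M : CommutativeMonoid a b) where

    private
      module M = CommutativeMonoid M
      open MonoidSum M renaming (sum to ⨁)
      module Multiple = MonoidMult M.monoid

    opaque
      -- Instantiated at the additive and the multiplicative monoid. Being opaque, it is handled
      -- later only through the laws of this block.
      ∑ : (Carrier → M.Carrier) → M.Carrier
      ∑ f = ⨁ (f ∘ enum)

      ∑-cong : ∀ {f g} → (∀ x → f x M.≈ g x) → ∑ f M.≈ ∑ g
      ∑-cong f≈g = sum-cong-≋ (f≈g ∘ enum)

      ∑-distrib : ∀ f g → ∑ (λ x → f x M.∙ g x) M.≈ ∑ f M.∙ ∑ g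
      ∑-distrib f g = ∑-distrib-+ (f ∘ enum) (g ∘ enum)

      ∑-swap : ∀ (f : Carrier → Carrier → M.Carrier) → ∑ (λ x → ∑ (f x)) M.≈ ∑ (λ y → ∑ (λ x → f x y))
      ∑-swap f = ∑-comm {q} {q} (λ i j → f (enum i) (enum j))

      -- The enumeration carries `π` to a permutation of the indices. Enumerating the index of y
      -- returns y only up to ≈, which is where the congruence of `f` enters.
      ∑-reindex : (π : Perm) (f : Carrier → M.Carrier) → (∀ {x y} → x ≈ y → f x M.≈ f y) →
                  ∑ (f ∘ Inverse.to π) M.≈ ∑ f
      ∑-reindex π f f-cong = M.sym (M.trans (sum-permute (f ∘ enum) π′)
        (sum-cong-≋ (λ i → f-cong (enum-index (to (enum i))))))
        where
        open Inverse π
        π′ : Perm.Permutation q q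
        π′ = Perm.permutation (index ∘ to ∘ enum) (index ∘ from ∘ enum)
          (λ i → ≡.trans (index-cong (inverseˡ (enum-index _))) (index-enum i))
          (λ i → ≡.trans (index-cong (inverseʳ (enum-index _))) (index-enum i))

      ∑-point : ∀ a (f : Carrier → M.Carrier) → (∀ {x y} → x ≈ y → f x M.≈ f y) →
                (∀ x → x ≉ a → f x M.≈ M.ε) → ∑ f M.≈ f a
      ∑-point a f f-cong f≈ε = M.trans (sum-remove {i = index a} (f ∘ enum))
        (M.trans (M.∙-cong (f-cong (enum-index a)) rest) (M.identityʳ _))
        where
        rest : ⨁ (λ j → f (enum (punchIn (index a) j))) M.≈ M.ε
        rest = M.trans
          (sum-cong-≋ (λ j → f≈ε _ (λ eq → Fin.punchInᵢ≢i (index a) j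
            (enum-injective (trans eq (sym (enum-index a)))))))
          (sum-replicate-zero (3 ℕ.+ n))

      ∑-const : ∀ a → ∑ (λ _ → a) M.≈ Multiple._×_ q a
      ∑-const a = sum-replicate q

      ∑-endo : (h : M.Carrier → M.Carrier) → (∀ {x y} → x M.≈ y → h x M.≈ h y) →
               h M.ε M.≈ M.ε → (∀ x y → h (x M.∙ y) M.≈ h x M.∙ h y) →
               ∀ f → ∑ (h ∘ f) M.≈ h (∑ f)
      ∑-endo h h-cong h-ε h-∙ f = go (f ∘ enum)
        where
        go : ∀ {k} (g : Fin k → M.Carrier) → ⨁ (h ∘ g) M.≈ h (⨁ g)
        go {zero}  g = M.sym h-ε
        go {suc k} g = M.trans (M.∙-congˡ (go (g ∘ suc))) (M.sym (h-∙ _ _))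

      -- Serves to see that a product of nonzero elements is nonzero.
      ∑-closed : ∀ {p} (P : M.Carrier → Set p) → P M.ε → (∀ {x y} → P x → P y → P (x M.∙ y)) →
                 ∀ {f} → (∀ x → P (f x)) → P (∑ f)
      ∑-closed P P-ε P-∙ {f} Pf = go (f ∘ enum) (Pf ∘ enum)
        where
        go : ∀ {k} (g : Fin k → M.Carrier) → (∀ i → P (g i)) → P (⨁ g)
        go {zero}  g Pg = P-ε
        go {suc k} g Pg = P-∙ (Pg zero) (go (g ∘ suc) (Pg ∘ suc))

  open OverField +-commutativeMonoid renaming (∑-const to ∑-const-·)
  open OverField *-commutativeMonoid using () renaming
    (∑ to ∏; ∑-cong to ∏-cong; ∑-distrib to ∏-distrib; ∑-reindex to ∏-reindex; ∑-point to ∏-point; ∑-const to ∏-const; ∑-closed to ∏-closed)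

  -- Inverses and the indicator of zero

  *-cancelˡ : ∀ {a x y} → a ≉ 0# → a * x ≈ a * y → x ≈ y
  *-cancelˡ {a} {x} {y} a≉0 ax≈ay = trans (sym (inverseʳ-≈ x)) (trans (from-cong ax≈ay) (inverseʳ-≈ y))
    where
    open Inverse (dilation a≉0) using (from-cong; inverseʳ)
    inverseʳ-≈ = λ x → inverseʳ {x} refl

  noZeroDivisors : ∀ {x y} → x ≉ 0# → x * y ≈ 0# → y ≈ 0#
  noZeroDivisors x≉0 xy≈0 = *-cancelˡ x≉0 (trans xy≈0 (sym (zeroʳ _)))

  x*y≉0 : ∀ {x y} → x ≉ 0# → y ≉ 0# → x * y ≉ 0#
  x*y≉0 x≉0 y≉0 xy≈0 = y≉0 (noZeroDivisors x≉0 xy≈0)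

  -- The nonzero elements are multiplied together by replacing 0 with 1, so that
  -- every product ranges over the whole field.
  0↦ : Carrier → Carrier → Carrier → Carrier
  0↦ a b x with x ≈? 0#
  ... | yes _ = a
  ... | no  _ = b

  0↦-zero : ∀ {a b x} → x ≈ 0# → 0↦ a b x ≈ a
  0↦-zero {x = x} x≈0 with x ≈? 0#
  ... | yes _   = refl
  ... | no  x≉0 = contradiction x≈0 x≉0

  0↦-nonzero : ∀ {a b x} → x ≉ 0# → 0↦ a b x ≈ b
  0↦-nonzero {x = x} x≉0 with x ≈? 0#
  ... | yes x≈0 = contradiction x≈0 x≉0
  ... | no  _   = refl

  -- Fermat's argument: multiplication by a ≠ 0 permutes the nonzero elements. With `φ` replacing 0
  -- by 1, passing from φ(x) to φ(a x) gains a factor a except at x = 0, where `ψ` supplies it;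
  -- elsewhere `ψ` is 1. Multiplying over all x gives P a = P a ^ q, and the nonzero P cancels.
  x^q≈x : ∀ x → x ^ q ≈ x
  x^q≈x a with a ≈? 0#
  ... | yes a≈0 = trans (*-congʳ a≈0) (trans (zeroˡ _) (sym a≈0))
  ... | no  a≉0 = sym (*-cancelˡ P≉0 (begin
    P * a                              ≈⟨ *-cong (∏-reindex (dilation a≉0) φ φ-cong) (trans (∏-point 0# ψ ψ-cong (λ _ → 0↦-nonzero)) (0↦-zero refl)) ⟨
    ∏ (φ ∘ (a *_)) * ∏ ψ                 ≈⟨ ∏-distrib (φ ∘ (a *_)) ψ ⟨
    ∏ (λ x → φ (a * x) * ψ x)          ≈⟨ ∏-cong φψ ⟩
    ∏ (λ x → φ x * a)                  ≈⟨ ∏-distrib φ (λ _ → a) ⟩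
    P * ∏ (λ _ → a)                    ≈⟨ *-congˡ (∏-const a) ⟩
    P * a ^ q                          ∎))
    where
    φ ψ : Carrier → Carrier
    φ x = 0↦ 1# x x
    ψ x = 0↦ a 1# x
    P = ∏ φ
    0↦-cong : ∀ {a b b′ x y} → x ≈ y → b ≈ b′ → 0↦ a b x ≈ 0↦ a b′ y
    0↦-cong {x = x} x≈y b≈b′ with x ≈? 0#
    ... | yes x≈0 = sym (0↦-zero (trans (sym x≈y) x≈0))
    ... | no  x≉0 = trans b≈b′ (sym (0↦-nonzero (λ y≈0 → x≉0 (trans x≈y y≈0))))
    φ-cong : Congruent φ
    φ-cong x≈y = 0↦-cong x≈y x≈y
    ψ-cong : Congruent ψ
    ψ-cong x≈y = 0↦-cong x≈y refl
    φ≉0 : ∀ x → φ x ≉ 0#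
    φ≉0 x with x ≈? 0#
    ... | yes _   = 1≉0
    ... | no  x≉0 = x≉0
    P≉0 = ∏-closed (_≉ 0#) 1≉0 x*y≉0 φ≉0
    φψ : ∀ x → φ (a * x) * ψ x ≈ φ x * a
    φψ x with x ≈? 0#
    ... | yes x≈0 = *-congʳ (0↦-zero (trans (*-congˡ x≈0) (zeroʳ a)))
    ... | no  x≉0 = trans (*-identityʳ _) (trans (0↦-nonzero (x*y≉0 a≉0 x≉0)) (*-comm a x))

  inv : Carrier → Carrier
  inv x = x ^ (2 ℕ.+ n)

  inv-cong : Congruent inv
  inv-cong = ^-congˡ (2 ℕ.+ n)

  inv-zero : ∀ {x} → x ≈ 0# → inv x ≈ 0#
  inv-zero x≈0 = trans (*-congʳ x≈0) (zeroˡ _)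

  x*inv-x≈1 : ∀ {x} → x ≉ 0# → x * inv x ≈ 1#
  -- By definition x * (x * inv x) is x ^ q.
  x*inv-x≈1 {x} x≉0 = *-cancelˡ x≉0 (trans (x^q≈x x) (sym (*-identityʳ x)))

  inv-unique : ∀ {x y} → x * y ≈ 1# → inv x ≈ y
  inv-unique {x} {y} xy≈1 = *-cancelˡ x≉0 (trans (x*inv-x≈1 x≉0) (sym xy≈1))
    where
    x≉0 : x ≉ 0#
    x≉0 x≈0 = 1≉0 (trans (sym xy≈1) (trans (*-congʳ x≈0) (zeroˡ y)))

  inv-involutive : ∀ x → inv (inv x) ≈ x
  inv-involutive x with x ≈? 0#
  ... | yes x≈0 = trans (inv-zero (inv-zero x≈0)) (sym x≈0)
  ... | no  x≉0 = inv-unique (trans (*-comm _ x) (x*inv-x≈1 x≉0))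

  inv-distrib-* : ∀ x y → inv (x * y) ≈ inv x * inv y
  inv-distrib-* x y = ^-distrib-* x y (2 ℕ.+ n)

  inv-1 : inv 1# ≈ 1#
  inv-1 = inv-unique (*-identityˡ 1#)

  inv-neg : ∀ x → inv (- x) ≈ - inv x
  inv-neg x with x ≈? 0#
  ... | yes x≈0 = trans (inv-zero (trans (-‿cong x≈0) -0#≈0#)) (sym (trans (-‿cong (inv-zero x≈0)) -0#≈0#))
  ... | no  x≉0 = inv-unique (trans (solve 2 (λ x y → (:- x) :* (:- y) := x :* y) refl x (inv x)) (x*inv-x≈1 x≉0))

  inversion : Perm
  inversion = mkPerm inv inv inv-cong inv-cong inv-involutive inv-involutive

  -- Like the next law, this holds at 0 as well, so that it can be used under a sum over the whole
  -- field.
  x*x*inv-x≈x : ∀ x → x * x * inv x ≈ x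
  x*x*inv-x≈x x = trans (*-assoc x x _) (x^q≈x x)

  x*inv-x*inv-x≈inv-x : ∀ x → x * (inv x * inv x) ≈ inv x
  x*inv-x*inv-x≈inv-x x = begin
    x * (inv x * inv x)            ≈⟨ *-comm _ _ ⟩
    inv x * inv x * x              ≈⟨ *-congˡ (inv-involutive x) ⟨
    inv x * inv x * inv (inv x)    ≈⟨ x*x*inv-x≈x (inv x) ⟩
    inv x                          ∎

  -- The indicator function of 0.
  δ : Carrier → Carrier
  δ x = 1# - x * inv x

  δ-cong : Congruent δ
  δ-cong x≈y = +-congˡ (-‿cong (*-cong x≈y (inv-cong x≈y)))

  δ-zero : ∀ {x} → x ≈ 0# → δ x ≈ 1#
  δ-zero {x} x≈0 = begin
    1# - x * inv x   ≈⟨ +-congˡ (-‿cong (trans (*-congʳ x≈0) (zeroˡ _))) ⟩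
    1# - 0#          ≈⟨ solve 0 (:1 :- :0 := :1) refl ⟩
    1#               ∎

  δ-nonzero : ∀ {x} → x ≉ 0# → δ x ≈ 0#
  δ-nonzero x≉0 = trans (+-congˡ (-‿cong (x*inv-x≈1 x≉0))) (-‿inverseʳ 1#)

  ≉⇒-≉0 : ∀ {x y} → x ≉ y → x - y ≉ 0#
  ≉⇒-≉0 x≉y eq = x≉y (x∙y⁻¹≈ε⇒x≈y _ _ eq)

  ≈⇒-≈0 : ∀ {x y} → x ≈ y → x - y ≈ 0#
  ≈⇒-≈0 = x≈y⇒x∙y⁻¹≈ε

  ∑-δ : ∀ {g} → Congruent g → ∀ a → ∑ (λ x → g x * δ (x - a)) ≈ g a
  ∑-δ {g} g-cong a = trans
    (∑-point a (λ x → g x * δ (x - a)) (λ x≈y → *-cong (g-cong x≈y) (δ-cong (+-congʳ x≈y)))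
      (λ x x≉a → trans (*-congˡ (δ-nonzero (≉⇒-≉0 x≉a))) (zeroʳ _)))
    (trans (*-congˡ (δ-zero (-‿inverseʳ a))) (*-identityʳ _))

  ∑-*ˡ : ∀ a f → ∑ (λ x → a * f x) ≈ a * ∑ f
  ∑-*ˡ a = ∑-endo (a *_) *-congˡ (zeroʳ a) (distribˡ a)

  ∑-*ʳ : ∀ f a → ∑ (λ x → f x * a) ≈ ∑ f * a
  ∑-*ʳ f a = ∑-endo (_* a) *-congʳ (zeroˡ a) (distribʳ a) f

  ∑-neg : ∀ f → ∑ (λ x → - f x) ≈ - ∑ f
  ∑-neg = ∑-endo -_ -‿cong -0#≈0# (λ x y → sym (-‿+-comm x y))

  ∑-minus : ∀ f g → ∑ (λ x → f x - g x) ≈ ∑ f - ∑ g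
  ∑-minus f g = trans (∑-distrib f (λ x → - g x)) (+-congˡ (∑-neg g))

  -- Translation by 1 permutes the field, so adding 1 to every term leaves the sum of all elements
  -- unchanged.
  q·1≈0 : q · 1# ≈ 0#
  q·1≈0 = trans (sym (∑-const-· 1#)) (+-identityʳ-unique (∑ (λ x → x)) _ (begin
    ∑ (λ x → x) + ∑ (λ _ → 1#)   ≈⟨ +-comm _ _ ⟩
    ∑ (λ _ → 1#) + ∑ (λ x → x)   ≈⟨ ∑-distrib (λ _ → 1#) (λ x → x) ⟨
    ∑ (λ x → 1# + x)             ≈⟨ ∑-reindex (translation 1#) (λ x → x) (λ eq → eq) ⟩
    ∑ (λ x → x)                  ∎))

  ∑-const : ∀ a → ∑ (λ _ → a) ≈ 0#
  ∑-const a = begin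
    ∑ (λ _ → a)         ≈⟨ ∑-cong (λ _ → *-identityˡ a) ⟨
    ∑ (λ _ → 1# * a)    ≈⟨ ∑-*ʳ (λ _ → 1#) a ⟩
    ∑ (λ _ → 1#) * a    ≈⟨ *-congʳ (trans (∑-const-· 1#) q·1≈0) ⟩
    0# * a              ≈⟨ zeroˡ a ⟩
    0#                  ∎

  -- The summand is 1 - δ(x); the constant sums to 0 and the indicator to 1. This is also the power
  -- sum of exponent q - 1, the one that does not vanish.
  ∑-x*inv-x : ∑ (λ x → x * inv x) ≈ - 1#
  ∑-x*inv-x = begin
    -- The factor 1 in front of the indicator gives the shape g(x) δ(x - a) of `∑-δ`, with constant
    -- g.
    ∑ (λ x → x * inv x)                ≈⟨ ∑-cong (λ x → solve 1 (λ y → y := :1 :- :1 :* (:1 :- y)) refl (x * inv x)) ⟩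
    ∑ (λ x → 1# - 1# * δ x)            ≈⟨ ∑-minus (λ _ → 1#) (λ x → 1# * δ x) ⟩
    ∑ (λ _ → 1#) - ∑ (λ x → 1# * δ x)  ≈⟨ +-cong (∑-const 1#) (-‿cong (trans (∑-cong (λ x → *-congˡ (δ-cong (x≈x-0 x)))) (∑-δ (λ _ → refl) 0#))) ⟩
    0# - 1#                            ≈⟨ +-identityˡ _ ⟩
    - 1#                               ∎
    where
    x≈x-0 : ∀ x → x ≈ x - 0#
    x≈x-0 = solve 1 (λ x → x := x :- :0) refl

  -- Power sums

  -- Coefficients in order of increasing degree, the leading coefficient 1 omitted.
  monic : ∀ {k} → Vec Carrier k → Carrier → Carrier
  monic []       x = 1#
  monic (c ∷ cs) x = c + x * monic cs x

  -- Synthetic division by x - r: the coefficients are the values at r of the successive Horner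
  -- tails.
  quotient : ∀ {k} → Vec Carrier (suc k) → Carrier → Vec Carrier k
  quotient (c ∷ [])         r = []
  quotient (c ∷ cs@(_ ∷ _)) r = monic cs r ∷ quotient cs r

  monic-quotient : ∀ {k} (cs : Vec Carrier (suc k)) r x →
                   monic cs x ≈ monic cs r + (x - r) * monic (quotient cs r) x
  monic-quotient (c ∷ [])         r x =
    solve 3 (λ c r x → c :+ x :* :1 := c :+ r :* :1 :+ (x :- r) :* :1) refl c r x
  monic-quotient (c ∷ cs@(_ ∷ _)) r x = begin
    c + x * monic cs x              ≈⟨ +-congˡ (*-congˡ (monic-quotient cs r x)) ⟩
    c + x * (h + (x - r) * g)       ≈⟨ solve 5 (λ c x r h g → c :+ x :* (h :+ (x :- r) :* g) := c :+ r :* h :+ (x :- r) :* (h :+ x :* g)) refl c x r h g ⟩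
    c + r * h + (x - r) * (h + x * g) ∎
    where
    h = monic cs r
    g = monic (quotient cs r) x

  -- Divide by x - r for the first root r. The other roots differ from r, so in the absence of zero
  -- divisors they are roots of the quotient; the descent ends at the constant 1.
  tooManyRoots : ∀ {k} (cs : Vec Carrier k) (ρ : Fin (suc k) → Carrier) →
                 Injective _≡_ _≈_ ρ → ¬ (∀ i → monic cs (ρ i) ≈ 0#)
  tooManyRoots []           ρ ρ-inj roots = 1≉0 (roots zero)
  tooManyRoots cs@(_ ∷ _) ρ ρ-inj roots =
    tooManyRoots (quotient cs r) (ρ ∘ suc) (Fin.suc-injective ∘ ρ-inj) (λ i →
      noZeroDivisors (≉⇒-≉0 (λ eq → Fin.0≢1+n (≡.sym (ρ-inj eq)))) (begin
        (ρ (suc i) - r) * monic (quotient cs r) (ρ (suc i))               ≈⟨ +-identityˡ _ ⟨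
        0# + (ρ (suc i) - r) * monic (quotient cs r) (ρ (suc i))          ≈⟨ +-congʳ (roots zero) ⟨
        monic cs r + (ρ (suc i) - r) * monic (quotient cs r) (ρ (suc i))  ≈⟨ monic-quotient cs r (ρ (suc i)) ⟨
        monic cs (ρ (suc i))                                              ≈⟨ roots (suc i) ⟩
        0#                                                                ∎))
    where
    r = ρ zero

  monic-replicate : ∀ k x → monic (Vec.replicate k 0#) x ≈ x ^ k
  monic-replicate zero    x = refl
  monic-replicate (suc k) x = trans (+-identityˡ _) (*-congˡ (monic-replicate k x))

  nonzero : Fin (3 ℕ.+ n) → Carrier
  nonzero i = enum (punchIn (index 0#) i)

  nonzero≉0 : ∀ i → nonzero i ≉ 0#
  nonzero≉0 i eq = Fin.punchInᵢ≢i (index 0#) i (enum-injective (trans eq (sym (enum-index 0#))))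

  -- The q - 1 nonzero elements outnumber the degree k + 1 of the polynomial x ^ (k + 1) - 1, so
  -- they are not all roots of it.
  x^k≉1 : ∀ k → suc k ≤ 2 ℕ.+ n → ∃ λ x → x ≉ 0# × x ^ suc k ≉ 1#
  x^k≉1 k k<q-2 with Fin.¬∀⟶∃¬ (3 ℕ.+ n) _ (λ i → (nonzero i ^ suc k) ≈? 1#) notAll
    where
    notAll : ¬ (∀ i → nonzero i ^ suc k ≈ 1#)
    -- The vector encodes x ^ (k + 1) - 1, and k + 2 of the nonzero elements are taken as roots.
    notAll all = tooManyRoots (- 1# ∷ Vec.replicate k 0#) (nonzero ∘ (λ i → Fin.inject≤ i (s≤s k<q-2)))
      (λ eq → Fin.inject≤-injective _ _ _ _ (Fin.punchIn-injective (index 0#) _ _ (enum-injective eq)))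
      (λ i → trans (+-congˡ (trans (*-congˡ (monic-replicate k _)) (all _))) (-‿inverseˡ 1#))
  ... | i , ≉1 = nonzero i , nonzero≉0 i , ≉1

  -- For positive k, choose a ≠ 0 with a ^ k ≠ 1. Substituting a x multiplies the sum by a ^ k, yet
  -- only permutes its terms.
  ∑-x^k≈0 : ∀ k → k ≤ 2 ℕ.+ n → ∑ (_^ k) ≈ 0#
  ∑-x^k≈0 zero    _     = ∑-const 1#
  ∑-x^k≈0 (suc k) k<q-2 with x^k≉1 k k<q-2
  ... | a , a≉0 , a^k≉1 = noZeroDivisors (≉⇒-≉0 a^k≉1) (begin
    (b - 1#) * S                ≈⟨ solve 2 (λ b s → (b :- :1) :* s := b :* s :- s) refl b S ⟩
    b * S - S                   ≈⟨ ≈⇒-≈0 (begin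
      b * S                       ≈⟨ ∑-*ˡ b (_^ suc k) ⟨
      ∑ (λ x → b * x ^ suc k)     ≈⟨ ∑-cong (λ x → ^-distrib-* a x (suc k)) ⟨
      ∑ (λ x → (a * x) ^ suc k)   ≈⟨ ∑-reindex (dilation a≉0) (_^ suc k) (^-congˡ (suc k)) ⟩
      S                           ∎) ⟩
    0#                          ∎)
    where
    b = a ^ suc k
    S = ∑ (_^ suc k)

  ∑-x≈0 : ∑ (λ x → x) ≈ 0#
  ∑-x≈0 = trans (∑-cong (λ x → sym (*-identityʳ x))) (∑-x^k≈0 1 (s≤s z≤n))

  ∑-inv≈0 : ∑ inv ≈ 0#
  ∑-inv≈0 = trans (∑-reindex inversion (λ x → x) (λ eq → eq)) ∑-x≈0

  -- Inversion turns this into the power sum of exponent 2, which vanishes because q > 3 makes 2 at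
  -- most q - 2.
  ∑-inv²≈0 : ∑ (λ x → inv x * inv x) ≈ 0#
  ∑-inv²≈0 = trans (∑-reindex inversion (λ x → x * x) (λ eq → *-cong eq eq))
    (trans (∑-cong (λ x → *-congˡ (sym (*-identityʳ x)))) (∑-x^k≈0 2 (s≤s (s≤s z≤n))))

  -- The sum of a b c f₃(a, b, c)

  swap₀₁ : Carrier → Carrier
  swap₀₁ x = x + δ x - δ (x - 1#)

  swap₀₁-cong : Congruent swap₀₁
  swap₀₁-cong x≈y = +-cong (+-cong x≈y (δ-cong x≈y)) (-‿cong (δ-cong (+-congʳ x≈y)))

  swap₀₁-0 : ∀ {x} → x ≈ 0# → swap₀₁ x ≈ 1#
  swap₀₁-0 {x} x≈0 = begin
    x + δ x - δ (x - 1#)   ≈⟨ +-cong (+-cong x≈0 (δ-zero x≈0)) (-‿cong (δ-nonzero (≉⇒-≉0 (λ x≈1 → 1≉0 (trans (sym x≈1) x≈0))))) ⟩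
    0# + 1# - 0#           ≈⟨ solve 0 (:0 :+ :1 :- :0 := :1) refl ⟩
    1#                     ∎

  swap₀₁-1 : ∀ {x} → x ≈ 1# → swap₀₁ x ≈ 0#
  swap₀₁-1 {x} x≈1 = begin
    x + δ x - δ (x - 1#)   ≈⟨ +-cong (+-cong x≈1 (δ-nonzero (λ x≈0 → 1≉0 (trans (sym x≈1) x≈0)))) (-‿cong (δ-zero (≈⇒-≈0 x≈1))) ⟩
    1# + 0# - 1#           ≈⟨ solve 0 (:1 :+ :0 :- :1 := :0) refl ⟩
    0#                     ∎

  swap₀₁-fix : ∀ {x} → x ≉ 0# → x ≉ 1# → swap₀₁ x ≈ x
  swap₀₁-fix {x} x≉0 x≉1 = begin
    x + δ x - δ (x - 1#)   ≈⟨ +-cong (+-congˡ (δ-nonzero x≉0)) (-‿cong (δ-nonzero (≉⇒-≉0 x≉1))) ⟩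
    x + 0# - 0#            ≈⟨ solve 1 (λ x → x :+ :0 :- :0 := x) refl x ⟩
    x                      ∎

  swap₀₁-involutive : ∀ x → swap₀₁ (swap₀₁ x) ≈ x
  swap₀₁-involutive x with x ≈? 0# | x ≈? 1#
  ... | yes x≈0 | _       = trans (swap₀₁-1 (swap₀₁-0 x≈0)) (sym x≈0)
  ... | no  _   | yes x≈1 = trans (swap₀₁-0 (swap₀₁-1 x≈1)) (sym x≈1)
  ... | no  x≉0 | no  x≉1 = trans (swap₀₁-cong (swap₀₁-fix x≉0 x≉1)) (swap₀₁-fix x≉0 x≉1)

  transposition : Perm
  transposition = mkPerm swap₀₁ swap₀₁ swap₀₁-cong swap₀₁-cong swap₀₁-involutive swap₀₁-involutive

  -- In the expansion of t the linear part u + x contributes u ∑ inv x + ∑ x inv x = -1, and the two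
  -- indicators pick out x = -u and x = 1 - u.
  ∑-inv*swap₀₁ : ∀ u → ∑ (λ x → inv x * swap₀₁ (u + x)) ≈ - 1# - inv u - inv (1# - u)
  ∑-inv*swap₀₁ u = begin
    ∑ (λ x → inv x * swap₀₁ (u + x))  ≈⟨ ∑-cong expand ⟩
    ∑ (λ x → inv x * u + x * inv x + inv x * δ (x - - u) - inv x * δ (x - (1# - u)))
      ≈⟨ ∑-minus (λ x → inv x * u + x * inv x + inv x * δ (x - - u)) (λ x → inv x * δ (x - (1# - u))) ⟩
    ∑ (λ x → inv x * u + x * inv x + inv x * δ (x - - u)) - ∑ (λ x → inv x * δ (x - (1# - u)))
      ≈⟨ +-cong (trans (∑-distrib (λ x → inv x * u + x * inv x) (λ x → inv x * δ (x - - u)))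
                       (+-cong (∑-distrib (λ x → inv x * u) (λ x → x * inv x)) (∑-δ inv-cong (- u))))
                (-‿cong (∑-δ inv-cong (1# - u))) ⟩
    ∑ (λ x → inv x * u) + ∑ (λ x → x * inv x) + inv (- u) - inv (1# - u)
      ≈⟨ +-congʳ (+-cong (+-cong (trans (∑-*ʳ inv u) (*-congʳ ∑-inv≈0)) ∑-x*inv-x) (inv-neg u)) ⟩
    0# * u + - 1# + - inv u - inv (1# - u)
      ≈⟨ solve 3 (λ u v w → :0 :* u :+ (:- :1) :+ :- v :- w := (:- :1) :- v :- w) refl u (inv u) (inv (1# - u)) ⟩
    - 1# - inv u - inv (1# - u)  ∎
    where
    expand : ∀ x → inv x * swap₀₁ (u + x) ≈ inv x * u + x * inv x + inv x * δ (x - - u) - inv x * δ (x - (1# - u))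
    expand x = begin
      inv x * (u + x + δ (u + x) - δ (u + x - 1#))
        ≈⟨ *-congˡ (+-cong (+-congˡ (δ-cong (solve 2 (λ u x → u :+ x := x :- :- u) refl u x)))
                           (-‿cong (δ-cong (solve 2 (λ u x → u :+ x :- :1 := x :- (:1 :- u)) refl u x)))) ⟩
      inv x * (u + x + δ (x - - u) - δ (x - (1# - u)))
        ≈⟨ solve 5 (λ x y u a b → y :* (u :+ x :+ a :- b) := y :* u :+ x :* y :+ y :* a :- y :* b) refl
             x (inv x) u (δ (x - - u)) (δ (x - (1# - u))) ⟩
      inv x * u + x * inv x + inv x * δ (x - - u) - inv x * δ (x - (1# - u)) ∎

  -2# : Carrier
  -2# = - (1# + 1#)

  -- Partial fractions: 1/(x(1 - x)) = 1/x + 1/(1 - x). With `inv` this fails only at x = 0 and x =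
  -- 1, where the left side is 0 and the right side 1. Both fractions sum to 0, so the two
  -- corrections make up the value.
  ∑-inv*inv[1-x] : ∑ (λ x → inv x * inv (1# - x)) ≈ -2#
  ∑-inv*inv[1-x] = begin
    ∑ (λ x → inv x * inv (1# - x))  ≈⟨ ∑-cong partialFractions ⟩
    ∑ (λ x → inv x + inv (1# - x) - 1# * δ (x - 0#) - 1# * δ (x - 1#))
      ≈⟨ trans (∑-minus (λ x → inv x + inv (1# - x) - 1# * δ (x - 0#)) (λ x → 1# * δ (x - 1#)))
          (+-cong (trans (∑-minus (λ x → inv x + inv (1# - x)) (λ x → 1# * δ (x - 0#)))
                         (+-cong (∑-distrib inv (λ x → inv (1# - x))) (-‿cong (∑-δ (λ _ → refl) 0#))))
                  (-‿cong (∑-δ (λ _ → refl) 1#))) ⟩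
    ∑ inv + ∑ (λ x → inv (1# - x)) - 1# - 1#
      ≈⟨ +-congʳ (+-congʳ (+-cong ∑-inv≈0 (trans (∑-reindex (reflection 1#) inv inv-cong) ∑-inv≈0))) ⟩
    0# + 0# - 1# - 1#
      ≈⟨ solve 0 (:0 :+ :0 :- :1 :- :1 := :- (:1 :+ :1)) refl ⟩
    -2# ∎
    where
    partialFractions : ∀ x → inv x * inv (1# - x) ≈ inv x + inv (1# - x) - 1# * δ (x - 0#) - 1# * δ (x - 1#)
    partialFractions x with x ≈? 0# | x ≈? 1#
    ... | yes x≈0 | _ = begin
      inv x * inv (1# - x)   ≈⟨ trans (*-congʳ (inv-zero x≈0)) (zeroˡ _) ⟩
      0#                     ≈⟨ solve 0 (:0 := :0 :+ :1 :- :1 :* :1 :- :1 :* :0) refl ⟩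
      0# + 1# - 1# * 1# - 1# * 0#
        ≈⟨ +-cong (+-cong (+-cong (inv-zero x≈0) (inv-unique (trans (*-identityʳ _) (trans (+-congˡ (-‿cong x≈0)) (solve 0 (:1 :- :0 := :1) refl)))))
                          (-‿cong (*-congˡ (δ-zero (≈⇒-≈0 x≈0)))))
                  (-‿cong (*-congˡ (δ-nonzero (≉⇒-≉0 (λ x≈1 → 1≉0 (trans (sym x≈1) x≈0)))))) ⟨
      inv x + inv (1# - x) - 1# * δ (x - 0#) - 1# * δ (x - 1#) ∎
    ... | no x≉0  | yes x≈1 = begin
      inv x * inv (1# - x)   ≈⟨ trans (*-congˡ (inv-zero (≈⇒-≈0 (sym x≈1)))) (zeroʳ _) ⟩
      0#                     ≈⟨ solve 0 (:0 := :1 :+ :0 :- :1 :* :0 :- :1 :* :1) refl ⟩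
      1# + 0# - 1# * 0# - 1# * 1#
        ≈⟨ +-cong (+-cong (+-cong (trans (inv-cong x≈1) inv-1) (inv-zero (≈⇒-≈0 (sym x≈1))))
                          (-‿cong (*-congˡ (δ-nonzero (≉⇒-≉0 x≉0)))))
                  (-‿cong (*-congˡ (δ-zero (≈⇒-≈0 x≈1)))) ⟨
      inv x + inv (1# - x) - 1# * δ (x - 0#) - 1# * δ (x - 1#) ∎
    ... | no x≉0  | no x≉1 = begin
      y * z
        -- The numerator 1 is split as x + (1 - x).
        ≈⟨ solve 3 (λ x y z → y :* z := x :* y :* z :+ y :* ((:1 :- x) :* z)) refl x y z ⟩
      x * y * z + y * ((1# - x) * z)
        ≈⟨ +-cong (*-congʳ (x*inv-x≈1 x≉0)) (*-congˡ (x*inv-x≈1 (≉⇒-≉0 (x≉1 ∘ sym)))) ⟩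
      1# * z + y * 1#
        ≈⟨ solve 2 (λ y z → :1 :* z :+ y :* :1 := y :+ z :- :1 :* :0 :- :1 :* :0) refl y z ⟩
      y + z - 1# * 0# - 1# * 0#
        ≈⟨ +-cong (+-congˡ (-‿cong (*-congˡ (δ-nonzero (≉⇒-≉0 x≉0))))) (-‿cong (*-congˡ (δ-nonzero (≉⇒-≉0 x≉1)))) ⟨
      y + z - 1# * δ (x - 0#) - 1# * δ (x - 1#) ∎
      where
      y = inv x
      z = inv (1# - x)

  -- For s ≠ 0, substituting s x pulls out the factor (inv s)² and leaves the case s = 1. For s = 0
  -- the sum is -∑ (inv x)² = 0.
  ∑-inv*inv[s-x] : ∀ s → ∑ (λ x → inv x * inv (s - x)) ≈ -2# * (inv s * inv s)
  ∑-inv*inv[s-x] s with s ≈? 0#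
  ... | yes s≈0 = begin
    ∑ (λ x → inv x * inv (s - x))  ≈⟨ ∑-cong (λ x → *-congˡ (trans (inv-cong (trans (+-congʳ s≈0) (+-identityˡ _))) (inv-neg x))) ⟩
    ∑ (λ x → inv x * - inv x)      ≈⟨ ∑-cong (λ x → sym (-‿distribʳ-* _ _)) ⟩
    ∑ (λ x → - (inv x * inv x))    ≈⟨ trans (∑-neg (λ x → inv x * inv x)) (-‿cong ∑-inv²≈0) ⟩
    - 0#                           ≈⟨ solve 1 (λ m → :- :0 := m :* (:0 :* :0)) refl -2# ⟩
    -2# * (0# * 0#)                ≈⟨ *-congˡ (*-cong (inv-zero s≈0) (inv-zero s≈0)) ⟨
    -2# * (inv s * inv s)          ∎
  ... | no  s≉0 = begin
    ∑ (λ x → inv x * inv (s - x))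
      ≈⟨ ∑-reindex (dilation s≉0) (λ x → inv x * inv (s - x)) (λ eq → *-cong (inv-cong eq) (inv-cong (+-congˡ (-‿cong eq)))) ⟨
    ∑ (λ x → inv (s * x) * inv (s - s * x))
      ≈⟨ ∑-cong (λ x → *-cong (inv-distrib-* s x)
           (trans (inv-cong (solve 2 (λ s x → s :- s :* x := s :* (:1 :- x)) refl s x)) (inv-distrib-* s (1# - x)))) ⟩
    ∑ (λ x → inv s * inv x * (inv s * inv (1# - x)))
      ≈⟨ ∑-cong (λ x → solve 3 (λ s x y → s :* x :* (s :* y) := s :* s :* (x :* y)) refl (inv s) (inv x) (inv (1# - x))) ⟩
    ∑ (λ x → inv s * inv s * (inv x * inv (1# - x)))
      ≈⟨ trans (∑-*ˡ (inv s * inv s) (λ x → inv x * inv (1# - x))) (*-congˡ ∑-inv*inv[1-x]) ⟩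
    inv s * inv s * -2#            ≈⟨ *-comm _ _ ⟩
    -2# * (inv s * inv s)          ∎

  -- Substituting 1 - x gives (1 - x)²/x = 1/x - 2 + x. The middle term has to be read as -2 x inv
  -- x, which vanishes at 0; its sum is 2, and the outer terms sum to 0.
  ∑-x²*inv[1-x] : ∑ (λ x → x * x * inv (1# - x)) ≈ - -2#
  ∑-x²*inv[1-x] = begin
    ∑ (λ x → x * x * inv (1# - x))
      ≈⟨ ∑-reindex (reflection 1#) (λ x → x * x * inv (1# - x)) (λ eq → *-cong (*-cong eq eq) (inv-cong (+-congˡ (-‿cong eq)))) ⟨
    ∑ (λ x → (1# - x) * (1# - x) * inv (1# - (1# - x)))
      ≈⟨ ∑-cong expand ⟩
    ∑ (λ x → inv x + -2# * (x * inv x) + x)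
      ≈⟨ trans (∑-distrib (λ x → inv x + -2# * (x * inv x)) (λ x → x)) (+-cong
           (trans (∑-distrib inv (λ x → -2# * (x * inv x))) (+-cong ∑-inv≈0
             (trans (∑-*ˡ -2# (λ x → x * inv x)) (*-congˡ ∑-x*inv-x)))) ∑-x≈0) ⟩
    0# + -2# * - 1# + 0#
      ≈⟨ solve 1 (λ m → :0 :+ m :* (:- :1) :+ :0 := :- m) refl -2# ⟩
    - -2# ∎
    where
    expand : ∀ x → (1# - x) * (1# - x) * inv (1# - (1# - x)) ≈ inv x + -2# * (x * inv x) + x
    expand x = begin
      (1# - x) * (1# - x) * inv (1# - (1# - x))
        ≈⟨ *-congˡ (inv-cong (solve 1 (λ x → :1 :- (:1 :- x) := x) refl x)) ⟩
      (1# - x) * (1# - x) * inv x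
        ≈⟨ solve 2 (λ x y → (:1 :- x) :* (:1 :- x) :* y
                          := y :+ (:- (:1 :+ :1)) :* (x :* y) :+ x :* x :* y) refl x (inv x) ⟩
      inv x + -2# * (x * inv x) + x * x * inv x   ≈⟨ +-congˡ (x*x*inv-x≈x x) ⟩
      inv x + -2# * (x * inv x) + x               ∎

  -- The function induced by f₃.
  F : Carrier → Carrier → Carrier → Carrier
  F a b c = swap₀₁ (inv (swap₀₁ (inv a + inv b)) + inv c)

  -- The value of ∑ (λ c → c * F a b c), as a function of s = inv a + inv b.
  G : Carrier → Carrier
  G s = - 1# - inv (inv (swap₀₁ s)) - inv (1# - inv (swap₀₁ s))

  G-cong : Congruent G
  G-cong eq = +-cong (+-congˡ (-‿cong (inv-cong eq′))) (-‿cong (inv-cong (+-congˡ (-‿cong eq′))))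
    where eq′ = inv-cong (swap₀₁-cong eq)

  ∑-c*F : ∀ a b → ∑ (λ c → c * F a b c) ≈ G (inv a + inv b)
  ∑-c*F a b = begin
    -- Writing c as inv (inv c) makes the summand a function of inv c, so that inversion reindexes
    -- the sum.
    ∑ (λ c → c * swap₀₁ (u + inv c))             ≈⟨ ∑-cong (λ c → *-congʳ (inv-involutive c)) ⟨
    ∑ (λ c → inv (inv c) * swap₀₁ (u + inv c))
      ≈⟨ ∑-reindex inversion (λ c → inv c * swap₀₁ (u + c)) (λ eq → *-cong (inv-cong eq) (swap₀₁-cong (+-congˡ eq))) ⟩
    ∑ (λ c → inv c * swap₀₁ (u + c))             ≈⟨ ∑-inv*swap₀₁ u ⟩
    G (inv a + inv b)                            ∎
    where u = inv (swap₀₁ (inv a + inv b))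

  -- The right side results from replacing t(s) by s in G, which is harmless: at s = 0 the factor
  -- (inv s)² is zero, and at s = 1 the two inverses subtracted in G merely exchange the values 1
  -- and 0.
  inv²*G : ∀ s → inv s * inv s * G s ≈ - (inv s * inv s + inv s + inv s * inv s * inv (1# - inv s))
  inv²*G s with s ≈? 0# | s ≈? 1#
  ... | yes s≈0 | _ = begin
    inv s * inv s * G s
      ≈⟨ *-congʳ (*-cong (inv-zero s≈0) (inv-zero s≈0)) ⟩
    0# * 0# * G s
      ≈⟨ solve 2 (λ g w → :0 :* :0 :* g := :- (:0 :* :0 :+ :0 :+ :0 :* :0 :* w))
           refl (G s) (inv (1# - inv s)) ⟩
    - (0# * 0# + 0# + 0# * 0# * inv (1# - inv s))
      ≈⟨ -‿cong (+-cong (+-cong (*-cong (inv-zero s≈0) (inv-zero s≈0)) (inv-zero s≈0)) (*-congʳ (*-cong (inv-zero s≈0) (inv-zero s≈0)))) ⟨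
    - (inv s * inv s + inv s + inv s * inv s * inv (1# - inv s)) ∎
  ... | no  _   | yes s≈1 = begin
    inv s * inv s * G s
      ≈⟨ *-cong (*-cong y≈1 y≈1) (+-cong (+-congˡ (-‿cong (inv-zero v≈0))) (-‿cong
           (trans (inv-cong (trans (+-congˡ (-‿cong v≈0)) (solve 0 (:1 :- :0 := :1) refl))) inv-1))) ⟩
    1# * 1# * (- 1# - 0# - 1#)
      ≈⟨ solve 0 (:1 :* :1 :* ((:- :1) :- :0 :- :1)
                  := :- (:1 :* :1 :+ :1 :+ :1 :* :1 :* :0)) refl ⟩
    - (1# * 1# + 1# + 1# * 1# * 0#)
      ≈⟨ -‿cong (+-cong (+-cong (*-cong y≈1 y≈1) y≈1) (*-cong (*-cong y≈1 y≈1) (inv-zero (≈⇒-≈0 (sym y≈1))))) ⟨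
    - (inv s * inv s + inv s + inv s * inv s * inv (1# - inv s)) ∎
    where
    y≈1 : inv s ≈ 1#
    y≈1 = trans (inv-cong s≈1) inv-1
    v≈0 : inv (swap₀₁ s) ≈ 0#
    v≈0 = inv-zero (swap₀₁-1 s≈1)
  ... | no  s≉0 | no  s≉1 = begin
    y * y * G s
      ≈⟨ *-congˡ (+-cong (+-congˡ (-‿cong (trans (inv-cong v≈y) (inv-involutive s)))) (-‿cong (inv-cong (+-congˡ (-‿cong v≈y))))) ⟩
    y * y * (- 1# - s - w)
      ≈⟨ solve 3 (λ s y w → y :* y :* ((:- :1) :- s :- w) := :- (y :* y :+ s :* (y :* y) :+ y :* y :* w)) refl s y w ⟩
    - (y * y + s * (y * y) + y * y * w)
      ≈⟨ -‿cong (+-congʳ (+-congˡ (x*inv-x*inv-x≈inv-x s))) ⟩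
    - (y * y + y + y * y * w) ∎
    where
    y = inv s
    w = inv (1# - y)
    v≈y : inv (swap₀₁ s) ≈ y
    v≈y = inv-cong (swap₀₁-fix s≉0 s≉1)

  -- Of the three terms in `inv²*G` the first two sum to 0, and inversion turns the third into
  -- `∑-x²*inv[1-x]`.
  ∑-inv²*G : ∑ (λ s → inv s * inv s * G s) ≈ -2#
  ∑-inv²*G = begin
    ∑ (λ s → inv s * inv s * G s)  ≈⟨ ∑-cong inv²*G ⟩
    ∑ (λ s → - (inv s * inv s + inv s + g (inv s)))
      ≈⟨ ∑-neg (λ s → inv s * inv s + inv s + g (inv s)) ⟩
    - ∑ (λ s → inv s * inv s + inv s + g (inv s))
      ≈⟨ -‿cong (trans (∑-distrib (λ s → inv s * inv s + inv s) (g ∘ inv)) (+-cong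
           (trans (∑-distrib (λ s → inv s * inv s) inv) (+-cong ∑-inv²≈0 ∑-inv≈0))
           (trans (∑-reindex inversion g (λ eq → *-cong (*-cong eq eq) (inv-cong (+-congˡ (-‿cong eq))))) ∑-x²*inv[1-x]))) ⟩
    - (0# + 0# + - -2#)
      ≈⟨ solve 1 (λ m → :- (:0 :+ :0 :+ :- m) := m) refl -2# ⟩
    -2# ∎
    where
    g : Carrier → Carrier
    g x = x * x * inv (1# - x)

  ∑-a*b*c*F : ∑ (λ a → ∑ (λ b → ∑ (λ c → a * (b * (c * F a b c))))) ≈ -2# * -2#
  ∑-a*b*c*F = begin
    ∑ (λ a → ∑ (λ b → ∑ (λ c → a * (b * (c * F a b c)))))
      ≈⟨ ∑-cong (λ a → ∑-cong (λ b → trans (∑-*ˡ a (λ c → b * (c * F a b c))) (*-congˡ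
           (trans (∑-*ˡ b (λ c → c * F a b c)) (*-congˡ (∑-c*F a b)))))) ⟩
    ∑ (λ a → ∑ (λ b → a * (b * G (inv a + inv b))))
      ≈⟨ ∑-cong (λ a → ∑-cong (λ b → *-cong (sym (inv-involutive a)) (*-congʳ (sym (inv-involutive b))))) ⟩
    ∑ (λ a → ∑ (λ b → g (inv a) (inv b)))
      ≈⟨ ∑-cong (λ a → ∑-reindex inversion (g (inv a)) (g-cong refl)) ⟩
    ∑ (λ a → ∑ (g (inv a)))
      ≈⟨ ∑-reindex inversion (λ a → ∑ (g a)) (λ eq → ∑-cong (λ b → g-cong eq refl)) ⟩
    ∑ (λ a → ∑ (g a))
      -- With b = s - a, the argument of `G` becomes s, and `G s` factors out of the sum over a.
      -- What remains inside is the convolution of `inv` with itself.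
      ≈⟨ ∑-cong (λ a → ∑-reindex (translation (- a)) (g a) (g-cong refl)) ⟨
    ∑ (λ a → ∑ (λ s → g a (- a + s)))
      ≈⟨ ∑-swap (λ a s → g a (- a + s)) ⟩
    ∑ (λ s → ∑ (λ a → g a (- a + s)))
      ≈⟨ ∑-cong (λ s → ∑-cong (λ a → trans (sym (*-assoc _ _ _)) (*-cong (*-congˡ (inv-cong (+-comm (- a) s)))
           (G-cong (solve 2 (λ a s → a :+ ((:- a) :+ s) := s) refl a s))))) ⟩
    ∑ (λ s → ∑ (λ a → inv a * inv (s - a) * G s))
      ≈⟨ ∑-cong (λ s → trans (∑-*ʳ (λ a → inv a * inv (s - a)) (G s)) (trans (*-congʳ (∑-inv*inv[s-x] s)) (*-assoc _ _ _))) ⟩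
    ∑ (λ s → -2# * (inv s * inv s * G s))
      ≈⟨ trans (∑-*ˡ -2# (λ s → inv s * inv s * G s)) (*-congˡ ∑-inv²*G) ⟩
    -2# * -2# ∎
    where
    g : Carrier → Carrier → Carrier
    g a b = inv a * (inv b * G (a + b))
    g-cong : ∀ {a a′ b b′} → a ≈ a′ → b ≈ b′ → g a b ≈ g a′ b′
    g-cong a≈a′ b≈b′ = *-cong (inv-cong a≈a′) (*-cong (inv-cong b≈b′) (G-cong (+-cong a≈a′ b≈b′)))

  -- The function induced by f₃ and its permutations

  open Polynomials K

  -- The sum of the powers x ^ k for k ≤ q - 2 is 1 at 0, is q - 1 = -1 at 1, and elsewhere is (x ^
  -- (q - 1) - 1)/(x - 1) = 0; that is δ(x) - δ(x - 1).
  eval-t≈swap₀₁ : ∀ x → eval K (t K q) (x ∷ []) ≈ swap₀₁ x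
  eval-t≈swap₀₁ x = trans (eval-t q x) (trans (+-congˡ geometric≈δ) (sym (+-assoc x (δ x) _)))
    where
    g = geometric x (3 ℕ.+ n)
    geometric≈δ : g ≈ δ x - δ (x - 1#)
    geometric≈δ with x ≈? 0# | x ≈? 1#
    ... | yes x≈0 | _ = begin
      -- This form of g brings in `geometric-telescopes` at x = 0, so that the powers of 0 need not
      -- be added up.
      g             ≈⟨ solve 2 (λ x g → g := x :* g :+ :1 :- ((x :- :1) :* g :+ :1)) refl x g ⟩
      x * g + 1# - ((x - 1#) * g + 1#)
                    ≈⟨ +-cong (+-congʳ (trans (*-congʳ x≈0) (zeroˡ g))) (-‿cong (trans (geometric-telescopes x (3 ℕ.+ n)) (trans (*-congʳ x≈0) (zeroˡ _)))) ⟩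
      0# + 1# - 0#  ≈⟨ +-congʳ (+-identityˡ 1#) ⟩
      1# - 0#       ≈⟨ +-cong (δ-zero x≈0) (-‿cong (δ-nonzero (≉⇒-≉0 (λ x≈1 → 1≉0 (trans (sym x≈1) x≈0))))) ⟨
      δ x - δ (x - 1#) ∎
    ... | no x≉0 | yes x≈1 = begin
      g                                   ≈⟨ geometric-1 x≈1 (3 ℕ.+ n) ⟩
      (3 ℕ.+ n) · 1#                      ≈⟨ solve 1 (λ a → a := :1 :+ a :- :1) refl _ ⟩
      q · 1# - 1#                         ≈⟨ +-congʳ q·1≈0 ⟩
      0# - 1#                             ≈⟨ +-cong (δ-nonzero x≉0) (-‿cong (δ-zero (≈⇒-≈0 x≈1))) ⟨
      δ x - δ (x - 1#)                    ∎
    ... | no x≉0 | no x≉1 = begin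
      g                 ≈⟨ noZeroDivisors (≉⇒-≉0 x≉1) (begin
        (x - 1#) * g              ≈⟨ solve 1 (λ a → a := a :+ :1 :- :1) refl _ ⟩
        (x - 1#) * g + 1# - 1#    ≈⟨ ≈⇒-≈0 (trans (geometric-telescopes x (3 ℕ.+ n)) (x*inv-x≈1 x≉0)) ⟩
        0#                        ∎) ⟩
      0#                ≈⟨ -‿inverseʳ 0# ⟨
      0# - 0#           ≈⟨ +-cong (δ-nonzero x≉0) (-‿cong (δ-nonzero (≉⇒-≉0 x≉1))) ⟨
      δ x - δ (x - 1#)  ∎

  eval-step : ∀ f g (v : Vec Carrier 3) →
    eval K (reduce K q (_⟦_⟧ K (t K q) (_↑_ K f (2 ℕ.+ n) ++ _↑_ K g (2 ℕ.+ n)))) v ≈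
    swap₀₁ (inv (eval K f v) + inv (eval K g v))
  eval-step f g v = begin
    eval K (reduce K q (_⟦_⟧ K (t K q) h)) v    ≈⟨ eval-reduce x^q≈x (_⟦_⟧ K (t K q) h) v ⟩
    eval K (_⟦_⟧ K (t K q) h) v                 ≈⟨ eval-⟦⟧ v (t K q) h ⟩
    eval K (t K q) (eval K h v ∷ [])            ≈⟨ eval-t≈swap₀₁ (eval K h v) ⟩
    swap₀₁ (eval K h v)
      ≈⟨ swap₀₁-cong (trans (eval-⊕ v (_↑_ K f (2 ℕ.+ n)) (_↑_ K g (2 ℕ.+ n))) (+-cong (eval-↑ v f (2 ℕ.+ n)) (eval-↑ v g (2 ℕ.+ n)))) ⟩
    swap₀₁ (inv (eval K f v) + inv (eval K g v)) ∎
    where h = _↑_ K f (2 ℕ.+ n) ++ _↑_ K g (2 ℕ.+ n)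

  eval-f₃ : ∀ a b c → eval K (f₃ K q) (a ∷ b ∷ c ∷ []) ≈ F a b c
  eval-f₃ a b c = trans (eval-step (f₂ K q) (X K (suc (suc zero))) v) (swap₀₁-cong (+-cong
    (inv-cong (trans (eval-step (f₁ K) (X K (suc zero)) v)
      (swap₀₁-cong (+-cong (inv-cong (eval-X v zero)) (inv-cong (eval-X v (suc zero)))))))
    (inv-cong (eval-X v (suc (suc zero))))))
    where v = a ∷ b ∷ c ∷ []

  -- An explicit permutation is kept, rather than mere bijectivity: it yields the local permutation
  -- property and also reindexes the sum in `∑-f₃`.
  f₃-perm : ∀ i v → ∃ λ (π : Perm) → ∀ x → eval K (f₃ K q) (v [ i ]≔ x) ≈ Inverse.to π x
  f₃-perm zero             (a ∷ b ∷ c ∷ []) =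
    inversion ⨾ translation (inv b) ⨾ transposition ⨾ inversion ⨾ translation (inv c) ⨾ transposition ,
    λ x → trans (eval-f₃ x b c) (swap₀₁-cong (trans (+-comm _ _) (+-congˡ (inv-cong (swap₀₁-cong (+-comm _ _))))))
  f₃-perm (suc zero)       (a ∷ b ∷ c ∷ []) =
    inversion ⨾ translation (inv a) ⨾ transposition ⨾ inversion ⨾ translation (inv c) ⨾ transposition ,
    λ x → trans (eval-f₃ a x c) (swap₀₁-cong (+-comm _ _))
  f₃-perm (suc (suc zero)) (a ∷ b ∷ c ∷ []) =
    inversion ⨾ translation (inv (swap₀₁ (inv a + inv b))) ⨾ transposition , eval-f₃ a b

  f₃-isLocalPermutation : IsLocalPermutationPolynomial K (f₃ K q)
  f₃-isLocalPermutation i v with f₃-perm i v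
  ... | π , f≈π = (λ {x} {y} fx≈fy → trans (sym (inverseʳ refl)) (inverseʳ (trans (sym (f≈π x)) (trans fx≈fy (f≈π y)))))
                , (λ y → from y , λ {z} z≈from-y → trans (f≈π z) (inverseˡ z≈from-y))
    where open Inverse π

  ∑-f₃ : ∀ i v → ∑ (λ x → eval K (f₃ K q) (v [ i ]≔ x)) ≈ 0#
  ∑-f₃ i v with f₃-perm i v
  ... | π , f≈π = trans (∑-cong f≈π) (trans (∑-reindex π (λ x → x) (λ eq → eq)) ∑-x≈0)

  -- Coefficients as sums over the field

  -- The basis dual to the monomials x ^ k, 0 ≤ k < q, for the pairing ∑ (λ x → f x * g x).
  dual : ℕ → Carrier → Carrier
  dual zero    x = δ x
  dual (suc k) x = - (x ^ (2 ℕ.+ n ℕ.∸ k))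

  -- Here 0 ^ 0 = 1 separates j = 0 from the rest. The function -x ^ (q - 1) could not replace `δ`
  -- as the dual of x ^ 0, since its pairing with x ^ (q - 1) is 1 as well.
  ∑-x^j*dual-0 : ∀ j → ∑ (λ x → x ^ j * dual 0 x) ≈ 0# ^ j
  ∑-x^j*dual-0 j = trans (∑-cong (λ x → *-congˡ (δ-cong (solve 1 (λ x → x := x :- :0) refl x)))) (∑-δ (^-congˡ j) 0#)

  ∑-x^j*dual-suc : ∀ j k → ∑ (λ x → x ^ j * dual (suc k) x) ≈ - ∑ (_^ (j ℕ.+ (2 ℕ.+ n ℕ.∸ k)))
  ∑-x^j*dual-suc j k = trans
    (∑-cong (λ x → trans (sym (-‿distribʳ-* _ _)) (-‿cong (sym (^-homo-* x j _)))))
    (∑-neg (_^ (j ℕ.+ (2 ℕ.+ n ℕ.∸ k))))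

  ∑-x^k*dual-k : ∀ k → k < q → ∑ (λ x → x ^ k * dual k x) ≈ 1#
  ∑-x^k*dual-k zero    _         = ∑-x^j*dual-0 0
  ∑-x^k*dual-k (suc k) (s≤s k<) = begin
    ∑ (λ x → x ^ suc k * dual (suc k) x)              ≈⟨ ∑-x^j*dual-suc (suc k) k ⟩
    - ∑ (_^ (suc k ℕ.+ (2 ℕ.+ n ℕ.∸ k)))              ≡⟨ ≡.cong (λ e → - ∑ (_^ suc e)) (ℕ.m+[n∸m]≡n (ℕ.≤-pred k<)) ⟩
    - ∑ (λ x → x * inv x)                             ≈⟨ -‿cong ∑-x*inv-x ⟩
    - - 1#                                            ≈⟨ -‿involutive 1# ⟩
    1#                                                ∎

  -- Against the dual of index k + 1 the total exponent is j + q - 2 - k, which equals q - 1 exactly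
  -- for j = k + 1. Below that it is at most q - 2; above it, x ^ q = x lowers it to between 1 and q
  -- - 2. Either way the power sum vanishes.
  ∑-x^j*dual-k : ∀ j k → j < q → k < q → j ≢ k → ∑ (λ x → x ^ j * dual k x) ≈ 0#
  ∑-x^j*dual-k zero    zero    _   _  0≢0 = contradiction ≡.refl 0≢0
  ∑-x^j*dual-k (suc j) zero    _   _  _   = trans (∑-x^j*dual-0 (suc j)) (zeroˡ _)
  ∑-x^j*dual-k j       (suc k) j<q k<q j≢1+k = trans (∑-x^j*dual-suc j k) (trans (-‿cong (powerSum (ℕ.<-cmp j (suc k)))) -0#≈0#)
    where
    k≤q-2 : k ≤ 2 ℕ.+ n
    k≤q-2 = ℕ.≤-pred (ℕ.≤-pred k<q)
    powerSum : Tri (j < suc k) (j ≡ suc k) (suc k < j) → ∑ (_^ (j ℕ.+ (2 ℕ.+ n ℕ.∸ k))) ≈ 0#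
    powerSum (tri< j<1+k _ _) = ∑-x^k≈0 _ (ℕ.≤-trans (ℕ.+-monoˡ-≤ _ (ℕ.≤-pred j<1+k)) (ℕ.≤-reflexive (ℕ.m+[n∸m]≡n k≤q-2)))
    powerSum (tri≈ _ j≡1+k _) = contradiction j≡1+k j≢1+k
    powerSum (tri> _ _ 1+k<j) with ℕ.m≤n⇒∃[o]m+o≡n 1+k<j
    ... | i , ≡.refl = begin
      ∑ (_^ (2 ℕ.+ k ℕ.+ i ℕ.+ (2 ℕ.+ n ℕ.∸ k)))   ≡⟨ ≡.cong (λ e → ∑ (_^ e)) exponent ⟩
      ∑ (_^ (i ℕ.+ q))                             ≈⟨ ∑-cong (λ x → trans (^-homo-* x i q) (trans (*-congˡ (x^q≈x x)) (*-comm _ x))) ⟩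
      ∑ (_^ suc i)                                 ≈⟨ ∑-x^k≈0 (suc i) (ℕ.≤-pred (ℕ.≤-pred (ℕ.≤-trans (s≤s (s≤s (s≤s (ℕ.m≤n+m i k)))) j<q))) ⟩
      0#                                           ∎
      where
      exponent : 2 ℕ.+ k ℕ.+ i ℕ.+ (2 ℕ.+ n ℕ.∸ k) ≡ i ℕ.+ q
      exponent = ≡.trans (≡.cong (ℕ._+ (2 ℕ.+ n ℕ.∸ k)) (ℕ.+-comm (2 ℕ.+ k) i))
        (≡.trans (ℕ.+-assoc i (2 ℕ.+ k) _) (≡.cong (λ e → i ℕ.+ (2 ℕ.+ e)) (ℕ.m+[n∸m]≡n k≤q-2)))

  ∑* : ∀ m → (Vec Carrier m → Carrier) → Carrier
  ∑* zero    f = f []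
  ∑* (suc m) f = ∑ (λ x → ∑* m (λ v → f (x ∷ v)))

  ∑*-cong : ∀ m {f g} → (∀ v → f v ≈ g v) → ∑* m f ≈ ∑* m g
  ∑*-cong zero    f≈g = f≈g []
  ∑*-cong (suc m) f≈g = ∑-cong (λ x → ∑*-cong m (λ v → f≈g (x ∷ v)))

  ∑*-zero : ∀ m → ∑* m (λ _ → 0#) ≈ 0#
  ∑*-zero zero    = refl
  ∑*-zero (suc m) = trans (∑-cong (λ _ → ∑*-zero m)) (∑-const 0#)

  ∑*-distrib : ∀ m f g → ∑* m (λ v → f v + g v) ≈ ∑* m f + ∑* m g
  ∑*-distrib zero    f g = refl
  ∑*-distrib (suc m) f g = trans
    (∑-cong (λ x → ∑*-distrib m (λ v → f (x ∷ v)) (λ v → g (x ∷ v))))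
    (∑-distrib (λ x → ∑* m (λ v → f (x ∷ v))) (λ x → ∑* m (λ v → g (x ∷ v))))

  ∑*-*ˡ : ∀ m a f → ∑* m (λ v → a * f v) ≈ a * ∑* m f
  ∑*-*ˡ zero    a f = refl
  ∑*-*ˡ (suc m) a f = trans (∑-cong (λ x → ∑*-*ˡ m a (λ v → f (x ∷ v)))) (∑-*ˡ a (λ x → ∑* m (λ v → f (x ∷ v))))

  ∑-∑*-swap : ∀ m (f : Carrier → Vec Carrier m → Carrier) →
              ∑ (λ x → ∑* m (f x)) ≈ ∑* m (λ v → ∑ (λ x → f x v))
  ∑-∑*-swap zero    f = refl
  ∑-∑*-swap (suc m) f = trans (∑-swap (λ x y → ∑* m (λ v → f x (y ∷ v)))) (∑-cong (λ y → ∑-∑*-swap m (λ x v → f x (y ∷ v))))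

  -- The order of summation is changed so that the i-th variable is summed first.
  ∑*-vanish : ∀ {m} (i : Fin m) f → (∀ v → ∑ (λ x → f (v [ i ]≔ x)) ≈ 0#) → ∑* m f ≈ 0#
  -- The entry `0#` is a placeholder that the update at i overwrites.
  ∑*-vanish {suc m} zero    f f≈0 = trans (∑-∑*-swap m (λ x v → f (x ∷ v))) (trans (∑*-cong m (λ v → f≈0 (0# ∷ v))) (∑*-zero m))
  ∑*-vanish {suc m} (suc i) f f≈0 = trans (∑-cong (λ x → ∑*-vanish i (λ v → f (x ∷ v)) (λ v → f≈0 (x ∷ v)))) (∑-const 0#)

  dual* : ∀ {m} → Exponent m → Vec Carrier m → Carrier
  dual* []      []      = 1#
  dual* (k ∷ e) (x ∷ v) = dual k x * dual* e v

  ∑*-monomial : ∀ {m} j (d : Exponent m) k e →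
    ∑* (suc m) (λ v → monomial v (j ∷ d) * dual* (k ∷ e) v) ≈
    ∑ (λ x → x ^ j * dual k x) * ∑* m (λ v → monomial v d * dual* e v)
  ∑*-monomial {m} j d k e = trans
    (∑-cong (λ x → trans
      (∑*-cong m (λ v → solve 4 (λ a b c d → a :* b :* (c :* d) := a :* c :* (b :* d)) refl (x ^ j) (monomial v d) (dual k x) (dual* e v)))
      (∑*-*ˡ m (x ^ j * dual k x) (λ v → monomial v d * dual* e v))))
    (∑-*ʳ (λ x → x ^ j * dual k x) _)

  ∑*-monomial-≡ : ∀ {m} {e : Exponent m} → VecAll.All (_< q) e → ∑* m (λ v → monomial v e * dual* e v) ≈ 1#
  ∑*-monomial-≡ {e = []}    []           = *-identityˡ 1#
  ∑*-monomial-≡ {e = k ∷ e} (k<q ∷ e<q) = trans (∑*-monomial k e k e)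
    (trans (*-cong (∑-x^k*dual-k k k<q) (∑*-monomial-≡ e<q)) (*-identityˡ 1#))

  ∑*-monomial-≢ : ∀ {m} {d e : Exponent m} → VecAll.All (_< q) d → VecAll.All (_< q) e → d ≢ e →
                  ∑* m (λ v → monomial v d * dual* e v) ≈ 0#
  ∑*-monomial-≢ {d = []}    {[]}    []           []           d≢e = contradiction ≡.refl d≢e
  ∑*-monomial-≢ {d = j ∷ d} {k ∷ e} (j<q ∷ d<q) (k<q ∷ e<q) d≢e with j ℕ.≟ k
  ... | yes j≡k = trans (∑*-monomial j d k e)
    (trans (*-congˡ (∑*-monomial-≢ d<q e<q (λ d≡e → d≢e (≡.cong₂ _∷_ j≡k d≡e)))) (zeroʳ _))
  ... | no  j≢k = trans (∑*-monomial j d k e) (trans (*-congʳ (∑-x^j*dual-k j k j<q k<q j≢k)) (zeroˡ _))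

  -- Both sides are additive over the list of terms, and on a single term the orthogonality of
  -- monomials and `dual*` yields its coefficient or 0.
  coeff≈∑* : ∀ {m} {f : Poly K m} → ReducedPoly q f → ∀ {e} → VecAll.All (_< q) e →
             coeff K f e ≈ ∑* m (λ v → eval K f v * dual* e v)
  coeff≈∑* {m} {[]}          []           e<q = sym (trans (∑*-cong m (λ v → zeroˡ _)) (∑*-zero m))
  coeff≈∑* {m} {(a , d) ∷ f} (d<q ∷ f<q) {e} e<q = begin
    (if does (≡-dec ℕ._≟_ d e) then a else 0#) + coeff K f e
      ≈⟨ +-cong (if-dec (_≈ a * ∑* m (λ v → monomial v d * dual* e v)) (≡-dec ℕ._≟_ d e)
           (λ { ≡.refl → sym (trans (*-congˡ (∑*-monomial-≡ e<q)) (*-identityʳ a)) })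
           (λ d≢e → sym (trans (*-congˡ (∑*-monomial-≢ d<q e<q d≢e)) (zeroʳ a))))
         (coeff≈∑* f<q e<q) ⟩
    a * ∑* m (λ v → monomial v d * dual* e v) + ∑* m (λ v → eval K f v * dual* e v)
      ≈⟨ +-congʳ (∑*-*ˡ m a (λ v → monomial v d * dual* e v)) ⟨
    ∑* m (λ v → a * (monomial v d * dual* e v)) + ∑* m (λ v → eval K f v * dual* e v)
      ≈⟨ ∑*-distrib m (λ v → a * (monomial v d * dual* e v)) (λ v → eval K f v * dual* e v) ⟨
    ∑* m (λ v → a * (monomial v d * dual* e v) + eval K f v * dual* e v)
      ≈⟨ ∑*-cong m (λ v → solve 4 (λ a x w y → a :* (x :* w) :+ y :* w := (a :* x :+ y) :* w) refl a (monomial v d) (dual* e v) (eval K f v)) ⟩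
    ∑* m (λ v → (a * monomial v d + eval K f v) * dual* e v) ∎

  -- At index q - 1 the dual function is -x ^ 0.
  dual*-constant : ∀ {m} (e : Exponent m) i v x y → Vec.lookup e i ≡ 3 ℕ.+ n →
                   dual* e (v [ i ]≔ x) ≈ dual* e (v [ i ]≔ y)
  dual*-constant (_ ∷ e) zero    (_ ∷ v) x y ≡.refl = *-congʳ (-‿cong (trans (x^0 x) (sym (x^0 y))))
    where
    x^0 : ∀ x → x ^ (2 ℕ.+ n ℕ.∸ (2 ℕ.+ n)) ≈ 1#
    x^0 x = reflexive (≡.cong (x ^_) (ℕ.n∸n≡0 n))
  dual*-constant (_ ∷ e) (suc i) (_ ∷ v) x y eq     = *-congˡ (dual*-constant e i v x y eq)

  coeff-top≈0 : ∀ {m} {f : Poly K m} → ReducedPoly q f → ∀ {e} → VecAll.All (_< q) e → ∀ i →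
                (∀ v → ∑ (λ x → eval K f (v [ i ]≔ x)) ≈ 0#) → Vec.lookup e i ≡ 3 ℕ.+ n → coeff K f e ≈ 0#
  coeff-top≈0 {f = f} f<q {e} e<q i ∑f≈0 eᵢ≡q-1 = trans (coeff≈∑* f<q e<q) (∑*-vanish i _ (λ v → begin
    ∑ (λ x → eval K f (v [ i ]≔ x) * dual* e (v [ i ]≔ x))
      -- Fixing the i-th entry at 0 makes the dual factor free of x, so that it leaves the sum.
      ≈⟨ ∑-cong (λ x → *-congˡ (dual*-constant e i v x 0# eᵢ≡q-1)) ⟩
    ∑ (λ x → eval K f (v [ i ]≔ x) * dual* e (v [ i ]≔ 0#))
      ≈⟨ ∑-*ʳ (λ x → eval K f (v [ i ]≔ x)) _ ⟩
    ∑ (λ x → eval K f (v [ i ]≔ x)) * dual* e (v [ i ]≔ 0#)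
      ≈⟨ trans (*-congʳ (∑f≈0 v)) (zeroˡ _) ⟩
    0# ∎))

  f₃-reduced : ReducedPoly q (f₃ K q)
  f₃-reduced = reduce-reduced (s≤s (s≤s z≤n)) _

  -- Reduction rules out entries from q on, and the vanishing sums `∑-f₃` rule out the entry q - 1.
  f₃-exponent≤ : ∀ e → coeff K (f₃ K q) e ≉ 0# → VecAll.All (_≤ 2 ℕ.+ n) e
  f₃-exponent≤ e ≉0 with VecAll.all? (ℕ._<? q) e
  ... | no  e≮q = contradiction (coeff-reduced≈0 f₃-reduced e≮q) ≉0
  ... | yes e<q = VecAll.lookup⁻ (λ i → ℕ.≤-pred (ℕ.≤∧≢⇒< (ℕ.≤-pred (VecAll.lookup⁺ e<q i))
    (λ eᵢ≡q-1 → ≉0 (coeff-top≈0 f₃-reduced e<q i (∑-f₃ i) eᵢ≡q-1))))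

  -- The dual function at q - 2 is -x, and the three signs combine to -1.
  coeff-f₃ : coeff K (f₃ K q) (Vec.replicate 3 (2 ℕ.+ n)) ≈ - (-2# * -2#)
  coeff-f₃ = begin
    coeff K (f₃ K q) e                                     ≈⟨ coeff≈∑* f₃-reduced (N<q ∷ N<q ∷ N<q ∷ []) ⟩
    ∑* 3 (λ v → eval K (f₃ K q) v * dual* e v)
      ≈⟨ ∑-cong (λ a → ∑-cong (λ b → ∑-cong (λ c → trans
           (*-cong (eval-f₃ a b c) (*-cong (dual-N a) (*-cong (dual-N b) (*-congʳ (dual-N c)))))
           (solve 4 (λ a b c f → f :* ((:- a) :* ((:- b) :* ((:- c) :* :1))) := (:- :1) :* (a :* (b :* (c :* f))))
             refl a b c (F a b c))))) ⟩
    ∑* 3 (λ v → - 1# * abcF v)                             ≈⟨ ∑*-*ˡ 3 (- 1#) abcF ⟩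
    - 1# * ∑* 3 abcF                                       ≈⟨ *-congˡ ∑-a*b*c*F ⟩
    - 1# * (-2# * -2#)                                     ≈⟨ -1*x≈-x _ ⟩
    - (-2# * -2#)                                          ∎
    where
    e : Exponent 3
    e = Vec.replicate 3 (2 ℕ.+ n)
    abcF : Vec Carrier 3 → Carrier
    abcF (a ∷ b ∷ c ∷ []) = a * (b * (c * F a b c))
    N<q : 2 ℕ.+ n < q
    N<q = s≤s (s≤s (s≤s (ℕ.n≤1+n n)))
    dual-N : ∀ x → dual (2 ℕ.+ n) x ≈ - x
    dual-N x = -‿cong (trans (reflexive (≡.cong (x ^_) (ℕ.m+n∸n≡m 1 n))) (*-identityʳ x))

  -- The coefficient -4 shows that the bound q - 2 is attained in all three variables at once.
  f₃-hasDegree : 1# + 1# ≉ 0# → HasDegree K (f₃ K q) (3 ℕ.* (2 ℕ.+ n))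
  f₃-hasDegree 2≉0 = (Vec.replicate 3 (2 ℕ.+ n) , (λ ≈0 → -≉0 (x*y≉0 (-≉0 2≉0) (-≉0 2≉0)) (trans (sym coeff-f₃) ≈0)) , ≡.refl)
                   , (λ e ≉0 → sum-≤ (f₃-exponent≤ e ≉0))
    where
    -≉0 : ∀ {x} → x ≉ 0# → - x ≉ 0#
    -≉0 x≉0 -x≈0 = x≉0 (trans (sym (-‿involutive _)) (trans (-‿cong -x≈0) -0#≈0#))
    sum-≤ : ∀ {m b} {e : Exponent m} → VecAll.All (_≤ b) e → Vec.sum e ≤ m ℕ.* b
    sum-≤ []           = z≤n
    sum-≤ (k≤b ∷ e≤b) = ℕ.+-mono-≤ k≤b (sum-≤ e≤b)

  -- The characteristic and the prime field

  module Characteristic {p r : ℕ} (p-prime : Prime p) (q≡p^r : q ≡ p ℕ.^ r) where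

    private instance
      p≢0 : ℕ.NonZero p
      p≢0 = prime⇒nonZero p-prime

    -- If p times 1 were nonzero, so would be its r-th power, which is q times 1.
    p·1≈0 : p · 1# ≈ 0#
    p·1≈0 = decidable-stable ((p · 1#) ≈? 0#) (λ p·1≉0 → power≉0 p·1≉0 r (trans (reflexive (≡.cong (_· 1#) (≡.sym q≡p^r))) q·1≈0))
      where
      power≉0 : p · 1# ≉ 0# → ∀ r → (p ℕ.^ r) · 1# ≉ 0#
      power≉0 p·1≉0 zero    eq = 1≉0 (trans (sym (+-identityʳ 1#)) eq)
      power≉0 p·1≉0 (suc r) eq = x*y≉0 p·1≉0 (power≉0 p·1≉0 r) (trans (sym (×1-homo-* p (p ℕ.^ r))) eq)

    -- Used for d = p, and for d = 2 under the assumption 1 + 1 = 0.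
    ·1-mod : ∀ d .{{_ : ℕ.NonZero d}} → d · 1# ≈ 0# → ∀ k → k · 1# ≈ (k % d) · 1#
    ·1-mod d d·1≈0 k = begin
      k · 1#                                   ≡⟨ ≡.cong (_· 1#) (m≡m%n+[m/n]*n k d) ⟩
      (k % d ℕ.+ k / d ℕ.* d) · 1#             ≈⟨ ×-homo-+ 1# (k % d) _ ⟩
      (k % d) · 1# + (k / d ℕ.* d) · 1#        ≈⟨ +-congˡ (trans (×1-homo-* (k / d) d) (trans (*-congˡ d·1≈0) (zeroʳ _))) ⟩
      (k % d) · 1# + 0#                        ≈⟨ +-identityʳ _ ⟩
      (k % d) · 1#                             ∎

    -- If 1 + 1 = 0, then p times 1 depends only on the parity of p. For odd p it would be 1,
    -- although it is 0; an even prime is 2.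
    2≉0 : p ≢ 2 → 1# + 1# ≉ 0#
    2≉0 p≢2 1+1≈0 with p % 2 in p%2 | m%n<n p 2 | ·1-mod 2 (trans (+-congˡ (+-identityʳ 1#)) 1+1≈0) p
    ... | 0           | _                  | _  with prime⇒irreducible p-prime (m%n≡0⇒n∣m p 2 p%2)
    ...   | inj₂ 2≡p = p≢2 (≡.sym 2≡p)
    2≉0 p≢2 1+1≈0 | 1 | _ | p·1≈1 = 1≉0 (trans (sym (+-identityʳ 1#)) (trans (sym p·1≈1) p·1≈0))
    2≉0 p≢2 1+1≈0 | suc (suc _) | s≤s (s≤s ()) | _

    natural⇒inPrimeField : ∀ {a} → Natural a → InPrimeField K p a
    natural⇒inPrimeField (k , a≈k) = Fin.fromℕ< (m%n<n k p) ,
      trans a≈k (trans (·1-mod p p·1≈0 k) (reflexive (≡.cong (_· 1#) (≡.sym (Fin.toℕ-fromℕ< (m%n<n k p))))))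

open import Data.Nat.Base using (_*_; _∸_; _^_)

mainTheorem14 : ∀ {c ℓ} (K : CommutativeRing c ℓ) (p r q : ℕ) →
    Prime p → p ≢ 2 → q ≡ p ^ r → 3 < q → IsFiniteField K q →
    IsLocalPermutationPolynomial K (f₃ K q) ×
    HasCoefficientsInPrimeField K p (f₃ K q) ×
    HasDegree K (f₃ K q) (3 * (q ∸ 2))
mainTheorem14 K p r (suc (suc (suc (suc n)))) p-prime p≢2 q≡p^r (s≤s (s≤s (s≤s (s≤s z≤n)))) isFiniteField =
  f₃-isLocalPermutation ,
  (λ e → natural⇒inPrimeField (natural-coeff (natural-f₃ q) e)) ,
  f₃-hasDegree (2≉0 p≢2)
  where
  open FiniteField K n isFiniteField
  open Characteristic {p} {r} p-prime q≡p^r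
  open Polynomials K using (natural-coeff; natural-f₃)
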